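{- Let $G=(A,B,E)$ be a normalized matching graph with $|A|\leq|B|$. Then the number of complete matchings from $A$ to $B$ in $G$ is at least $\sqrt{\binom{|B|}{|A|}}$.
   Context: A bipartite graph $G=(A,B,E)$ is a normalized matching graph if for every $X\subseteq A$ we have $|X|/|A|\leq|\Gamma(X)|/|B|$, where $\Gamma(X)$ is the set of neighbours of $X$ in $B$. A complete matching from $A$ to $B$ is a matching in $G$ covering every vertex of $A$. -}

module Defs where

open import Data.Nat using (ℕ; zero; suc; _*_; _≤_)
open import Data.Bool using (Bool; true; false; _∧_; _∨_; not)
open import Data.Fin using (Fin; zero; suc; _≟_)
open import Data.Fin.Subset using (Subset; ∣_∣)
open import Data.Vec using (Vec; []; _∷_; tabulate; lookup)
open import Data.List using (List; []; _∷_; map; concatMap; filter; length)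
open import Data.List.Relation.Unary.All using (All)
open import Data.Vec.Relation.Unary.Any using ()
open import Relation.Nullary.Decidable using (⌊_⌋)
open import Relation.Binary.PropositionalEquality using (_≡_)

BipGraph : ℕ → ℕ → Set
BipGraph a b = Fin a → Fin b → Bool

anyFin : {n : ℕ} → (Fin n → Bool) → Bool
anyFin {zero}  p = false
anyFin {suc n} p = p zero ∨ anyFin (λ i → p (suc i))

allFin : {n : ℕ} → (Fin n → Bool) → Bool
allFin {zero}  p = true
allFin {suc n} p = p zero ∧ allFin (λ i → p (suc i))

Γ : {a b : ℕ} → BipGraph a b → Subset a → Subset b
Γ E X = tabulate (λ y → anyFin (λ x → lookup X x ∧ E x y))

-- Normalized matching graph: |X|/|A| ≤ |Γ(X)|/|B| for all X ⊆ A,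
-- written cross-multiplied (|A| = a, |B| = b).
NormalizedMatching : {a b : ℕ} → BipGraph a b → Set
NormalizedMatching {a} {b} E = (X : Subset a) → ∣ X ∣ * b ≤ ∣ Γ E X ∣ * a

allVecs : (a b : ℕ) → List (Vec (Fin b) a)
allVecs zero    b = [] ∷ []
allVecs (suc a) b =
  concatMap (λ y → map (y ∷_) (allVecs a b)) (allFinList b)
  where
  allFinList : (n : ℕ) → List (Fin n)
  allFinList zero    = []
  allFinList (suc n) = zero ∷ map suc (allFinList n)

-- A map f : A → B (as a vector) is a complete matching from A to B iff
-- every x is adjacent to f x and f is injective (the edges {x, f x}
-- are pairwise disjoint and cover A).
isCompleteMatching : {a b : ℕ} → BipGraph a b → Vec (Fin b) a → Bool
isCompleteMatching E f =
  allFin (λ x → E x (lookup f x))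
  ∧ allFin (λ x → allFin (λ x' → ⌊ x ≟ x' ⌋ ∨ not ⌊ lookup f x ≟ lookup f x' ⌋))

numCompleteMatchings : {a b : ℕ} → BipGraph a b → ℕ
numCompleteMatchings {a} {b} E =
  length (Data.List.filter (λ f → isCompleteMatching E f ≟b true) (allVecs a b))
  where open import Data.Bool using () renaming (_≟_ to _≟b_)

{-# OPTIONS --safe #-}
module Submission where

-- Let b = a + r. Sending b units out of every x ∈ A and at most a into every y ∈ B is possible by
-- Hall's theorem; completing this flow by r rows of ones gives a square matrix with line sums b,
-- hence b permutations, and so b complete matchings such that every y is covered by at most a of
-- them and missed by at most r of them.
--
-- The images of complete matchings are the bases of a matroid of rank a. If k bases have
-- multiplicity at most m at every element, then the bases D weighted by the product of the
-- multiplicities over D have total weight at least k ^ a, because an independent set is extended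
-- inside any given basis; hence there are at least (k / m) ^ a bases. This gives
-- b ^ a ≤ N a ^ a and, for the dual matroid, b ^ r ≤ N r ^ r. With d the smaller of a and r we have
-- 2 d ≤ b, and then (b C d) d ^ 2d ≤ b ^ 2d follows by induction on b.

open import Defs
open import Algebra.Properties.Semiring.Sum using ()
open import Data.Bool using (Bool; true; false; _∧_; _∨_; not) renaming (_≟_ to _≟ᵇ_)
open import Data.Bool.Properties using (∨-zeroʳ)
open import Data.Empty using (⊥-elim)
open import Data.Fin using (Fin; zero; suc; _≟_; _↑ˡ_; _↑ʳ_; splitAt)
open import Data.Fin.Properties using (any?; all?; suc-injective; splitAt-↑ˡ; splitAt-↑ʳ; ↑ˡ-injective)
open import Data.Fin.Subset using (Subset; ∣_∣; _∈_; _∉_; _⊆_; _∪_; _∩_; ∁; ⊥; ⁅_⁆)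
open import Data.Fin.Subset.Properties
  using (anySubset?; drop-∷-⊆; s⊆s; out⊆; ⊥⊆; ∣⊥∣≡0; _∈?_; ∉⊥; x∈⁅x⁆; x∈⁅y⁆⇒x≡y;
    x∈p∪q⁺; x∈p∪q⁻; x∈p∩q⁺; x∈p∩q⁻; x∈p⇒x∉∁p; x∈∁p⇒x∉p; x∉p⇒x∈∁p; ∣∁p∣≡n∸∣p∣)
open import Data.List using (List; []; _∷_; map; concatMap; filter; length)
open import Data.List.Membership.Propositional using () renaming (_∈_ to _∈ₗ_)
open import Data.List.Membership.Propositional.Properties
  using (∈-map⁺; ∈-map⁻; ∈-concatMap⁺; ∈-filter⁺; ∈-filter⁻)
open import Data.List.Properties using (length-map)
open import Data.List.Relation.Unary.Any as Any using (here; there)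
open import Data.Nat hiding (_≟_)
open import Data.Nat.Combinatorics
  using (_C_; nCk≡nC[n∸k]; nCn≡1; k>n⇒nCk≡0; nCk+nC[k+1]≡[n+1]C[k+1]; nCk≡n!/k![n-k]!; k![n∸k]!∣n!)
open import Data.Nat.DivMod using (m/n*n≡m)
open import Data.Nat.Properties hiding (_≟_; suc-injective)
open import Data.Nat.Solver using (module +-*-Solver)
open import Data.Product using (∃; ∃₂; _×_; _,_; proj₁; proj₂)
open import Data.Sum using (_⊎_; inj₁; inj₂; [_,_]′)
open import Data.Vec using (Vec; []; _∷_; here; there; lookup; tabulate; replicate; zipWith; _[_]%=_; _[_]≔_)
open import Data.Vec.Properties
  using (lookup∘tabulate; lookup-replicate; lookup-zipWith; lookup∘update; lookup∘update′;
    []=⇒lookup; lookup⇒[]=)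
open import Function using (_∘_; case_of_)
open import Relation.Nullary using (Dec; yes; no; contradiction)
open import Relation.Nullary.Decidable using (_×-dec_; _→-dec_; ¬?; ⌊_⌋)
open import Relation.Binary.PropositionalEquality

open Algebra.Properties.Semiring.Sum +-*-semiring
  using (sum; sum-cong-≗; ∑-distrib-+; ∑-comm; *-distribˡ-sum)

-- Completeness of the enumeration `allVecs`

-- The list of all of Fin b inside allVecs has no name in scope, so it is written _ below and found by
-- unification. Replacing map by a variable M lets the unifier compare its arguments, and abstracting
-- suc m in tail-complete separates the two arguments b of that list, so that induction on one of
-- them is possible.
concat-complete : ∀ {m k} (M : (Fin m → Fin (suc m)) → List (Fin m) → List (Fin (suc m)))
  (vs : List (Vec (Fin (suc m)) k)) → M ≡ map → (xs : List (Fin m)) →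
  (∀ y → y ∈ₗ xs) → (∀ v → v ∈ₗ vs) → ∀ v →
  v ∈ₗ concatMap (λ y → map (y ∷_) vs) (zero ∷ M suc xs)
concat-complete _ vs refl xs all-xs all-vs (y ∷ v) =
  ∈-concatMap⁺ (λ y → map (y ∷_) vs) (Any.map (λ { refl → ∈-map⁺ (y ∷_) (all-vs v) }) (mem y))
  where
  mem : ∀ y → y ∈ₗ zero ∷ map suc xs
  mem zero    = here refl
  mem (suc y) = there (∈-map⁺ suc (all-xs y))

mutual
  hidden-complete : ∀ a p m (y : Fin m) → y ∈ₗ _
  tail-complete : ∀ a m (y : Fin m) → y ∈ₗ _

  ∈-allVecs : ∀ a b (v : Vec (Fin b) a) → v ∈ₗ allVecs a b
  ∈-allVecs zero b [] = here refl
  ∈-allVecs (suc a) zero (() ∷ v)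
  ∈-allVecs (suc a) (suc m) v with map {A = Fin m} {B = Fin (suc m)} in eq
  ... | M = concat-complete M (allVecs a (suc m)) (sym eq) _ (tail-complete a m) (∈-allVecs a (suc m)) v

  tail-complete a m y with suc m
  ... | p = hidden-complete a p m y

  hidden-complete a p (suc m) zero = here refl
  hidden-complete a p (suc m) (suc y) = there (∈-map⁺ suc (hidden-complete a p m y))

-- Finite sums, indicators and weights

sum-mono : ∀ {n} {f g : Fin n → ℕ} → (∀ i → f i ≤ g i) → sum f ≤ sum g
sum-mono {zero}  f≤g = z≤n
sum-mono {suc n} f≤g = +-mono-≤ (f≤g zero) (sum-mono (f≤g ∘ suc))

term≤sum : ∀ {n} (f : Fin n → ℕ) i → f i ≤ sum f
term≤sum f zero    = m≤m+n _ _
term≤sum f (suc i) = ≤-trans (term≤sum (f ∘ suc) i) (m≤n+m _ _)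

two-terms≤sum : ∀ {n} (f : Fin n → ℕ) {i j} → i ≢ j → f i + f j ≤ sum f
two-terms≤sum f {zero}  {zero}  i≢j = contradiction refl i≢j
two-terms≤sum f {zero}  {suc j} i≢j = +-monoʳ-≤ (f zero) (term≤sum (f ∘ suc) j)
two-terms≤sum f {suc i} {zero}  i≢j =
  ≤-trans (≤-reflexive (+-comm (f (suc i)) (f zero))) (+-monoʳ-≤ (f zero) (term≤sum (f ∘ suc) i))
two-terms≤sum f {suc i} {suc j} i≢j =
  ≤-trans (two-terms≤sum (f ∘ suc) (i≢j ∘ cong suc)) (m≤n+m _ _)

-- If the terms are comparable and the totals lose nothing, no single term can be strictly smaller.
-- This later turns "at most once" into "exactly once".
sum-mono-≤⇒≥ : ∀ {n} {f g : Fin n → ℕ} → (∀ i → f i ≤ g i) → sum g ≤ sum f → ∀ i → g i ≤ f i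
sum-mono-≤⇒≥ {suc n} {f} {g} f≤g G≤F zero =
  +-cancelʳ-≤ (sum (g ∘ suc)) _ _ (≤-trans G≤F (+-monoʳ-≤ (f zero) (sum-mono (f≤g ∘ suc))))
sum-mono-≤⇒≥ {suc n} {f} {g} f≤g G≤F (suc i) =
  sum-mono-≤⇒≥ (f≤g ∘ suc)
    (+-cancelˡ-≤ (f zero) _ _ (≤-trans (+-monoˡ-≤ _ (f≤g zero)) G≤F)) i

sum-const : ∀ n c → sum {n} (λ _ → c) ≡ n * c
sum-const zero    c = refl
sum-const (suc n) c = cong (c +_) (sum-const n c)

sum-zero : ∀ n → sum {n} (λ _ → 0) ≡ 0
sum-zero n = trans (sum-const n 0) (*-zeroʳ n)

sum-≡0 : ∀ {n} {f : Fin n → ℕ} → (∀ i → f i ≡ 0) → sum f ≡ 0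
sum-≡0 {n} f≡0 = trans (sum-cong-≗ f≡0) (sum-zero n)

sum-pos⇒∃ : ∀ {n} (f : Fin n → ℕ) → 1 ≤ sum f → ∃ λ i → 1 ≤ f i
sum-pos⇒∃ {suc n} f 1≤F with f zero in eq
... | suc _ = zero , subst (1 ≤_) (sym eq) (s≤s z≤n)
... | zero  with sum-pos⇒∃ (f ∘ suc) 1≤F
...   | i , 1≤fi = suc i , 1≤fi

-- Recursion on both indices, instead of a test with `_≟_`, lets `sum (δ (suc i))` reduce to
-- `sum (δ i)`.
δ : ∀ {n} → Fin n → Fin n → ℕ
δ zero    zero    = 1
δ zero    (suc _) = 0
δ (suc _) zero    = 0
δ (suc i) (suc j) = δ i j

δ-refl : ∀ {n} (i : Fin n) → δ i i ≡ 1
δ-refl zero    = refl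
δ-refl (suc i) = δ-refl i

δ-≢ : ∀ {n} {i j : Fin n} → i ≢ j → δ i j ≡ 0
δ-≢ {i = zero}  {zero}  i≢j = contradiction refl i≢j
δ-≢ {i = zero}  {suc j} i≢j = refl
δ-≢ {i = suc i} {zero}  i≢j = refl
δ-≢ {i = suc i} {suc j} i≢j = δ-≢ (i≢j ∘ cong suc)

δ≤ : ∀ {n} {i : Fin n} (f : Fin n → ℕ) → 1 ≤ f i → ∀ j → δ i j ≤ f j
δ≤ {i = i} f 1≤fi j with i ≟ j
... | yes refl = subst (_≤ f i) (sym (δ-refl i)) 1≤fi
... | no i≢j   = subst (_≤ f j) (sym (δ-≢ i≢j)) z≤n

sum-δ : ∀ {n} (i : Fin n) → sum (δ i) ≡ 1
sum-δ {suc n} zero = cong suc (sum-zero n)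
sum-δ (suc i)      = sum-δ i

select : Bool → ℕ → ℕ
select true  n = n
select false n = 0

select-zero : ∀ p → select p 0 ≡ 0
select-zero true  = refl
select-zero false = refl

select-mono : ∀ p {m n} → m ≤ n → select p m ≤ select p n
select-mono true  m≤n = m≤n
select-mono false m≤n = z≤n

select-+ : ∀ p m n → select p (m + n) ≡ select p m + select p n
select-+ true  m n = refl
select-+ false m n = refl

select-sum : ∀ {n} p (f : Fin n → ℕ) → select p (sum f) ≡ sum (λ i → select p (f i))
select-sum true  f = refl
select-sum {n} false f = sym (sum-zero n)

weight : ∀ {n} → (Fin n → Bool) → (Fin n → ℕ) → ℕ
weight P f = sum (λ i → select (P i) (f i))

weight-δ : ∀ {n} (P : Fin n → Bool) i → weight P (δ i) ≡ select (P i) 1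
weight-δ P zero = begin
  select (P zero) 1 + weight (P ∘ suc) (λ _ → 0)  ≡⟨ cong (select (P zero) 1 +_) (sum-≡0 (λ i → select-zero (P (suc i)))) ⟩
  select (P zero) 1 + 0                           ≡⟨ +-identityʳ _ ⟩
  select (P zero) 1                               ∎
  where open ≡-Reasoning
weight-δ P (suc i) = cong₂ _+_ (select-zero (P zero)) (weight-δ (P ∘ suc) i)

weight-cong : ∀ {n} {P Q : Fin n → Bool} f → (∀ i → P i ≡ Q i) → weight P f ≡ weight Q f
weight-cong f P≗Q = sum-cong-≗ (λ i → cong (λ p → select p (f i)) (P≗Q i))

weight-+ : ∀ {n} (P : Fin n → Bool) f g → weight P (λ i → f i + g i) ≡ weight P f + weight P g
weight-+ P f g =
  trans (sum-cong-≗ (λ i → select-+ (P i) (f i) (g i)))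
        (∑-distrib-+ (λ i → select (P i) (f i)) (λ i → select (P i) (g i)))

decrement : ∀ {n} → Fin n → (Fin n → ℕ) → Fin n → ℕ
decrement i f j = f j ∸ δ i j

decrement-+-δ : ∀ {n} {i : Fin n} f → 1 ≤ f i → ∀ j → decrement i f j + δ i j ≡ f j
decrement-+-δ f 1≤fi j = m∸n+n≡m (δ≤ f 1≤fi j)

weight-decrement : ∀ {n} (P : Fin n → Bool) {i} f → 1 ≤ f i →
  weight P f ≡ weight P (decrement i f) + select (P i) 1
weight-decrement P {i} f 1≤fi = begin
  weight P f                                    ≡⟨ sum-cong-≗ (λ j → cong (select (P j)) (decrement-+-δ f 1≤fi j)) ⟨
  weight P (λ j → decrement i f j + δ i j)      ≡⟨ weight-+ P (decrement i f) (δ i) ⟩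
  weight P (decrement i f) + weight P (δ i)     ≡⟨ cong (weight P (decrement i f) +_) (weight-δ P i) ⟩
  weight P (decrement i f) + select (P i) 1     ∎
  where open ≡-Reasoning

-- Hall's theorem with demands r and capacities c

-- `Y` may be any set containing the neighbours of `X`, not only the neighbourhood itself. Such
-- pairs are stable under componentwise meet and join, which is all that the uncrossing in Hall's
-- theorem needs.
Closed : ∀ {a b} → BipGraph a b → (Fin a → Bool) → (Fin b → Bool) → Set
Closed E X Y = ∀ x y → X x ≡ true → E x y ≡ true → Y y ≡ true

closed? : ∀ {a b} (E : BipGraph a b) X Y → Dec (Closed E X Y)
closed? E X Y = all? λ x → all? λ y → (X x ≟ᵇ true) →-dec ((E x y ≟ᵇ true) →-dec (Y y ≟ᵇ true))

HallCondition : ∀ {a b} → BipGraph a b → (Fin a → ℕ) → (Fin b → ℕ) → Set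
HallCondition E r c = ∀ X Y → Closed E X Y → weight X r ≤ weight Y c

record Flow {a b : ℕ} (E : BipGraph a b) (r : Fin a → ℕ) (c : Fin b → ℕ) : Set where
  field
    amount  : Fin a → Fin b → ℕ
    support : ∀ x y → E x y ≡ false → amount x y ≡ 0
    rows    : ∀ x → sum (amount x) ≡ r x
    columns : ∀ y → sum (λ x → amount x y) ≤ c y

open Flow

zero-flow : ∀ {a b} {E : BipGraph a b} {r c} → (∀ x → r x ≡ 0) → Flow E r c
zero-flow {a} {b} r≡0 = record
  { amount  = λ _ _ → 0
  ; support = λ _ _ _ → refl
  ; rows    = λ x → trans (sum-zero b) (sym (r≡0 x))
  ; columns = λ y → subst (_≤ _) (sym (sum-zero a)) z≤n
  }

edge-flow : ∀ {a b} {E : BipGraph a b} {x y} → E x y ≡ true → Flow E (δ x) (δ y)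
edge-flow {a} {b} {E} {x} {y} Exy = record
  { amount  = λ x′ y′ → δ x x′ * δ y y′
  ; support = off-edge
  ; rows    = λ x′ → trans (sym (*-distribˡ-sum (δ x x′) (δ y)))
                       (trans (cong (δ x x′ *_) (sum-δ y)) (*-identityʳ _))
  ; columns = λ y′ → ≤-reflexive (begin
      sum (λ x′ → δ x x′ * δ y y′)  ≡⟨ sum-cong-≗ (λ x′ → *-comm (δ x x′) (δ y y′)) ⟩
      sum (λ x′ → δ y y′ * δ x x′)  ≡⟨ *-distribˡ-sum (δ y y′) (δ x) ⟨
      δ y y′ * sum (δ x)            ≡⟨ cong (δ y y′ *_) (sum-δ x) ⟩
      δ y y′ * 1                    ≡⟨ *-identityʳ _ ⟩
      δ y y′                        ∎)
  }
  where
  open ≡-Reasoning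
  off-edge : ∀ x′ y′ → E x′ y′ ≡ false → δ x x′ * δ y y′ ≡ 0
  off-edge x′ y′ ¬E with x ≟ x′ | y ≟ y′
  ... | no x≢x′  | _        = cong (_* δ y y′) (δ-≢ x≢x′)
  ... | yes _    | no y≢y′  = trans (cong (δ x x′ *_) (δ-≢ y≢y′)) (*-zeroʳ (δ x x′))
  ... | yes refl | yes refl = case trans (sym ¬E) Exy of λ ()

add-flows : ∀ {a b} {E : BipGraph a b} {r r₁ r₂ c c₁ c₂} →
  (∀ x → r₁ x + r₂ x ≡ r x) → (∀ y → c₁ y + c₂ y ≡ c y) →
  Flow E r₁ c₁ → Flow E r₂ c₂ → Flow E r c
add-flows r-sum c-sum w₁ w₂ = record
  { amount  = λ x y → amount w₁ x y + amount w₂ x y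
  ; support = λ x y ¬E → cong₂ _+_ (support w₁ x y ¬E) (support w₂ x y ¬E)
  ; rows    = λ x → trans (∑-distrib-+ (amount w₁ x) (amount w₂ x))
                      (trans (cong₂ _+_ (rows w₁ x) (rows w₂ x)) (r-sum x))
  ; columns = λ y → ≤-trans
      (≤-reflexive (∑-distrib-+ (λ x → amount w₁ x y) (λ x → amount w₂ x y)))
      (≤-trans (+-mono-≤ (columns w₁ y) (columns w₂ y)) (≤-reflexive (c-sum y)))
  }

restrict : ∀ {n} → (Fin n → Bool) → (Fin n → ℕ) → Fin n → ℕ
restrict P f i = select (P i) (f i)

restrict-split : ∀ {n} (P : Fin n → Bool) f i → restrict P f i + restrict (not ∘ P) f i ≡ f i
restrict-split P f i with P i
... | true  = +-identityʳ _
... | false = refl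

weight-restrict : ∀ {n} (P Q : Fin n → Bool) f →
  weight P (restrict Q f) ≡ weight (λ i → P i ∧ Q i) f
weight-restrict P Q f = sum-cong-≗ (λ i → select-∧ (P i) (Q i) (f i))
  where
  select-∧ : ∀ p q n → select p (select q n) ≡ select (p ∧ q) n
  select-∧ true  q n = refl
  select-∧ false q n = refl

weight-restrict-not : ∀ {n} (P Q : Fin n → Bool) f →
  weight P (restrict (not ∘ Q) f) + weight Q f ≡ weight (λ i → P i ∨ Q i) f
weight-restrict-not P Q f = trans (sym (∑-distrib-+ (λ i → select (P i) (restrict (not ∘ Q) f i)) (λ i → select (Q i) (f i))))
  (sum-cong-≗ (λ i → select-∨ (P i) (Q i) (f i)))
  where
  select-∨ : ∀ p q n → select p (select (not q) n) + select q n ≡ select (p ∨ q) n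
  select-∨ true  true  n = refl
  select-∨ true  false n = +-identityʳ n
  select-∨ false true  n = refl
  select-∨ false false n = refl

Closed-∧ : ∀ {a b} {E : BipGraph a b} {X X′ Y Y′} → Closed E X Y → Closed E X′ Y′ →
  Closed E (λ x → X x ∧ X′ x) (λ y → Y y ∧ Y′ y)
Closed-∧ {X = X} {X′} cl cl′ x y XX′ Exy with X x in X≡ | X′ x in X′≡
... | true | true = cong₂ _∧_ (cl x y X≡ Exy) (cl′ x y X′≡ Exy)

Closed-∨ : ∀ {a b} {E : BipGraph a b} {X X′ Y Y′} → Closed E X Y → Closed E X′ Y′ →
  Closed E (λ x → X x ∨ X′ x) (λ y → Y y ∨ Y′ y)
Closed-∨ {X = X} {X′} {Y} {Y′} cl cl′ x y XX′ Exy with X x in X≡ | X′ x in X′≡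
... | true  | _    = cong (_∨ Y′ y) (cl x y X≡ Exy)
... | false | true = trans (cong (Y y ∨_) (cl′ x y X′≡ Exy)) (∨-zeroʳ (Y y))

module _ {a b} {E : BipGraph a b} {r : Fin a → ℕ} {c : Fin b → ℕ} (hall : HallCondition E r c)
  {X Y} (closed : Closed E X Y) where

  -- Hall's condition for the meet of `(Z , W)` with `(X , Y)`.
  HallCondition-restrict : HallCondition E (restrict X r) (restrict Y c)
  HallCondition-restrict Z W cl = subst₂ _≤_
    (sym (weight-restrict Z X r)) (sym (weight-restrict W Y c))
    (hall _ _ (Closed-∧ cl closed))

  -- Hall's condition for the join of `(Z , W)` with `(X , Y)`; tightness allows the weights of `X`
  -- and `Y` to be cancelled.
  HallCondition-restrict-not : weight X r ≡ weight Y c →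
    HallCondition E (restrict (not ∘ X) r) (restrict (not ∘ Y) c)
  HallCondition-restrict-not tight Z W cl = +-cancelʳ-≤ (weight X r) _ _ (begin
    weight Z (restrict (not ∘ X) r) + weight X r  ≡⟨ weight-restrict-not Z X r ⟩
    weight (λ x → Z x ∨ X x) r                    ≤⟨ hall _ _ (Closed-∨ cl closed) ⟩
    weight (λ y → W y ∨ Y y) c                    ≡⟨ weight-restrict-not W Y c ⟨
    weight W (restrict (not ∘ Y) c) + weight Y c  ≡⟨ cong (_ +_) tight ⟨
    weight W (restrict (not ∘ Y) c) + weight X r  ∎)
    where open ≤-Reasoning

-- Hall's condition is tested on the singleton of `x` and its neighbourhood: if no neighbour had
-- capacity left, the right side would be 0.
positive-neighbour : ∀ {a b} {E : BipGraph a b} {r c} → HallCondition E r c →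
  ∀ x → 1 ≤ r x → ∃ λ y → E x y ≡ true × 1 ≤ c y
positive-neighbour {E = E} {r} {c} hall x 1≤rx with any? (λ y → (E x y ≟ᵇ true) ×-dec (1 ≤? c y))
... | yes found = found
... | no  none  = contradiction (begin-strict
    0                                    <⟨ 1≤rx ⟩
    r x                                  ≡⟨ cong (λ p → select p (r x)) (sym X-x) ⟩
    select (X x) (r x)                   ≤⟨ term≤sum (λ x′ → select (X x′) (r x′)) x ⟩
    weight X r                           ≤⟨ hall X (E x) closed ⟩
    weight (E x) c                       ≡⟨ sum-≡0 empty ⟩
    0                                    ∎) (<-irrefl refl)
  where
  open ≤-Reasoning
  X : _ → Bool
  X x′ = ⌊ x ≟ x′ ⌋
  X-x : X x ≡ true
  X-x with x ≟ x
  ... | yes _  = refl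
  ... | no x≢x = contradiction refl x≢x
  closed : Closed E X (E x)
  closed x′ y X-x′ E-x′y with x ≟ x′
  closed x′ y X-x′ E-x′y | yes refl = E-x′y
  empty : ∀ y → select (E x y) (c y) ≡ 0
  empty y with E x y in Exy | c y in cy
  ... | false | _     = refl
  ... | true  | zero  = refl
  ... | true  | suc _ = contradiction (y , Exy , subst (1 ≤_) (sym cy) (s≤s z≤n)) none

-- The search for a violating pair runs over `Subset`, where quantification is decidable; `tabulate`
-- transfers an arbitrary pair of predicates there.
HallCondition? : ∀ {a b} (E : BipGraph a b) r c →
  HallCondition E r c ⊎ (∃₂ λ X Y → Closed E X Y × weight Y c < weight X r)
HallCondition? E r c
  with anySubset? (λ X → anySubset? (λ Y →
         closed? E (lookup X) (lookup Y) ×-dec (weight (lookup Y) c <? weight (lookup X) r)))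
... | yes (X , Y , violation) = inj₂ (lookup X , lookup Y , violation)
... | no  none = inj₁ λ X Y cl → ≮⇒≥ λ c<r → none
    ( tabulate X , tabulate Y
    , (λ x y X-x Exy → trans (lookup∘tabulate Y y) (cl x y (trans (sym (lookup∘tabulate X x)) X-x) Exy))
    , subst₂ _<_ (weight-cong c (λ y → sym (lookup∘tabulate Y y)))
                 (weight-cong r (λ x → sym (lookup∘tabulate X x))) c<r )

weight+weight-not : ∀ {n} (P : Fin n → Bool) f → weight P f + weight (not ∘ P) f ≡ sum f
weight+weight-not P f =
  trans (sym (∑-distrib-+ (restrict P f) (restrict (not ∘ P) f))) (sum-cong-≗ (restrict-split P f))

weight-pos : ∀ {n} (P : Fin n → Bool) f {i} → P i ≡ true → 1 ≤ f i → 1 ≤ weight P f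
weight-pos P f {i} Pi 1≤fi =
  ≤-trans (subst (λ p → 1 ≤ select p (f i)) (sym Pi) 1≤fi) (term≤sum (restrict P f) i)

select≤ : ∀ p n → select p n ≤ n
select≤ true  n = ≤-refl
select≤ false n = z≤n

-- Sending one unit along an edge x y can only destroy Hall's condition at a pair (X , Y) that was
-- tight before, and then the problem splits into the parts inside and outside of (X , Y).
tight-pair : ∀ {a b} {E : BipGraph a b} {r c} → HallCondition E r c → ∀ {x y} → 1 ≤ r x → 1 ≤ c y →
  ∀ {X Y} → Closed E X Y → weight Y (decrement y c) < weight X (decrement x r) →
  X x ≡ false × Y y ≡ true × weight X r ≡ weight Y c
tight-pair {r = r} {c} hall {x} {y} 1≤rx 1≤cy {X} {Y} closed Y<X = conclude
  where
  r⁻ = weight X (decrement x r)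
  c⁻ = weight Y (decrement y c)
  slack : r⁻ + select (X x) 1 ≤ c⁻ + select (Y y) 1
  slack = subst₂ _≤_ (weight-decrement X r 1≤rx) (weight-decrement Y c 1≤cy) (hall X Y closed)
  conclude : X x ≡ false × Y y ≡ true × weight X r ≡ weight Y c
  conclude with X x in X-x | Y y in Y-y | slack
  ... | true  | q     | s = contradiction
    (+-cancelʳ-≤ 1 _ _ (≤-trans s (+-monoʳ-≤ c⁻ (select≤ q 1)))) (<⇒≱ Y<X)
  ... | false | false | s = contradiction
    (subst₂ _≤_ (+-identityʳ r⁻) (+-identityʳ c⁻) s) (<⇒≱ Y<X)
  ... | false | true  | s = refl , refl , ≤-antisym (hall X Y closed) (begin
    weight Y c               ≡⟨ weight-decrement Y c 1≤cy ⟩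
    c⁻ + select (Y y) 1      ≡⟨ cong (λ q → c⁻ + select q 1) Y-y ⟩
    c⁻ + 1                   ≡⟨ +-comm c⁻ 1 ⟩
    suc c⁻                   ≤⟨ Y<X ⟩
    r⁻                       ≤⟨ m≤m+n r⁻ _ ⟩
    r⁻ + select (X x) 1      ≡⟨ weight-decrement X r 1≤rx ⟨
    weight X r               ∎)
    where open ≤-Reasoning

-- Induction on `n`, a bound for the total demand. One unit is sent from some `x` to a neighbour `y`
-- if Hall's condition survives this; otherwise a tight pair splits the problem in two. In both
-- cases the total demand drops.
hall-flow : ∀ {a b} {E : BipGraph a b} n r c → sum r ≤ n → HallCondition E r c → Flow E r c
hall-flow {a} {b} {E} n r c Σr≤n hall with any? (λ x → 1 ≤? r x)
... | no  none        = zero-flow (λ x → n<1⇒n≡0 (≰⇒> (λ 1≤rx → none (x , 1≤rx))))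
... | yes (x , 1≤rx) = go n Σr≤n
  where
  go : ∀ n → sum r ≤ n → Flow E r c
  go zero    Σr≤0 = contradiction (≤-trans 1≤rx (≤-trans (term≤sum r x) Σr≤0)) (λ ())
  go (suc n) Σr≤n with positive-neighbour hall x 1≤rx
  ... | y , Exy , 1≤cy with HallCondition? E (decrement x r) (decrement y c)
  ...   | inj₁ hall⁻ = add-flows (decrement-+-δ r 1≤rx) (decrement-+-δ c 1≤cy)
                         (hall-flow n _ _ (≤-pred smaller) hall⁻) (edge-flow Exy)
    where
    smaller : suc (sum (decrement x r)) ≤ suc n
    smaller = begin
      suc (sum (decrement x r))         ≡⟨ +-comm 1 _ ⟩
      sum (decrement x r) + 1           ≡⟨ weight-decrement (λ _ → true) r 1≤rx ⟨
      sum r                             ≤⟨ Σr≤n ⟩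
      suc n                             ∎
      where open ≤-Reasoning
  ...   | inj₂ (X , Y , closed , Y<X) with tight-pair hall 1≤rx 1≤cy closed Y<X
  ...     | X-x , Y-y , tight = add-flows (restrict-split X r) (restrict-split Y c)
              (hall-flow n _ _ (≤-pred inside) (HallCondition-restrict hall closed))
              (hall-flow n _ _ (≤-pred outside) (HallCondition-restrict-not hall closed tight))
    where
    open ≤-Reasoning
    -- `x` lies outside `X` and has positive demand.
    inside : suc (weight X r) ≤ suc n
    inside = begin
      suc (weight X r)                  ≡⟨ +-comm 1 _ ⟩
      weight X r + 1                    ≤⟨ +-monoʳ-≤ _ (weight-pos (not ∘ X) r (cong not X-x) 1≤rx) ⟩
      weight X r + weight (not ∘ X) r   ≡⟨ weight+weight-not X r ⟩
      sum r                             ≤⟨ Σr≤n ⟩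
      suc n                             ∎
    -- `y` lies in `Y` and has positive capacity, so by tightness the demand inside `X` is positive
    -- too.
    outside : suc (weight (not ∘ X) r) ≤ suc n
    outside = begin
      1 + weight (not ∘ X) r            ≤⟨ +-monoˡ-≤ _ (weight-pos Y c Y-y 1≤cy) ⟩
      weight Y c + weight (not ∘ X) r   ≡⟨ cong (_+ _) tight ⟨
      weight X r + weight (not ∘ X) r   ≡⟨ weight+weight-not X r ⟩
      sum r                             ≤⟨ Σr≤n ⟩
      suc n                             ∎

positive : ℕ → Bool
positive zero    = false
positive (suc _) = true

positive⇒1≤ : ∀ {n} → positive n ≡ true → 1 ≤ n
positive⇒1≤ {suc n} _ = s≤s z≤n

support⁻ : ∀ {a b} {E : BipGraph a b} {r c} (w : Flow E r c) {x y} → 1 ≤ amount w x y → E x y ≡ true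
support⁻ {E = E} w {x} {y} 1≤wxy with E x y in Exy
... | true  = refl
... | false = contradiction (subst (1 ≤_) (support w x y Exy) 1≤wxy) (λ ())

weight-const : ∀ {n} (P : Fin n → Bool) k → weight P (λ _ → k) ≡ k * weight P (λ _ → 1)
weight-const P k = trans (sum-cong-≗ (λ i → select-* (P i)))
                         (sym (*-distribˡ-sum k (λ i → select (P i) 1)))
  where
  select-* : ∀ p → select p k ≡ k * select p 1
  select-* true  = sym (*-identityʳ k)
  select-* false = sym (*-zeroʳ k)

weight-⊆ : ∀ {n} {P Q : Fin n → Bool} f → (∀ i → P i ≡ true → Q i ≡ true) → weight P f ≤ weight Q f
weight-⊆ {P = P} {Q} f P⊆Q = sum-mono λ i → select-⊆ (P i) (Q i) (f i) (P⊆Q i)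
  where
  select-⊆ : ∀ p q n → (p ≡ true → q ≡ true) → select p n ≤ select q n
  select-⊆ false q n p⊆q = z≤n
  select-⊆ true  q n p⊆q rewrite p⊆q refl = ≤-refl

-- Decomposing a square matrix with constant line sums into permutation matrices

-- Bijectivity of `perm i` is expressed by the column sums of its matrix: in this form it can be
-- subtracted from `W`, and later split over two blocks of rows.
record PermutationDecomposition {n} (k : ℕ) (W : Fin n → Fin n → ℕ) : Set where
  field
    perm       : Fin k → Fin n → Fin n
    surjective : ∀ i y → sum (λ x → δ (perm i x) y) ≡ 1
    total      : ∀ x y → sum (λ i → δ (perm i x) y) ≡ W x y

open PermutationDecomposition

-- Double counting: the rows in `X` carry `k` each, all of it lies in columns of `Y`, and these hold
-- at most `k` each.
positive-HallCondition : ∀ {n} k .{{_ : NonZero k}} (W : Fin n → Fin n → ℕ) →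
  (∀ x → sum (W x) ≡ k) → (∀ y → sum (λ x → W x y) ≤ k) →
  HallCondition (λ x y → positive (W x y)) (λ _ → 1) (λ _ → 1)
positive-HallCondition k W rowsW colsW X Y closed = *-cancelˡ-≤ k (begin
  k * weight X (λ _ → 1)                            ≡⟨ weight-const X k ⟨
  sum (λ x → select (X x) k)                        ≡⟨ sum-cong-≗ (λ x → cong (select (X x)) (rowsW x)) ⟨
  sum (λ x → select (X x) (sum (W x)))              ≡⟨ sum-cong-≗ (λ x → select-sum (X x) (W x)) ⟩
  sum (λ x → sum (λ y → select (X x) (W x y)))      ≤⟨ sum-mono (λ x → sum-mono (λ y → move x y)) ⟩
  sum (λ x → sum (λ y → select (Y y) (W x y)))      ≡⟨ ∑-comm (λ x y → select (Y y) (W x y)) ⟩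
  sum (λ y → sum (λ x → select (Y y) (W x y)))      ≡⟨ sum-cong-≗ (λ y → select-sum (Y y) (λ x → W x y)) ⟨
  sum (λ y → select (Y y) (sum (λ x → W x y)))      ≤⟨ sum-mono (λ y → select-mono (Y y) (colsW y)) ⟩
  sum (λ y → select (Y y) k)                        ≡⟨ weight-const Y k ⟩
  k * weight Y (λ _ → 1)                            ∎)
  where
  open ≤-Reasoning
  move : ∀ x y → select (X x) (W x y) ≤ select (Y y) (W x y)
  move x y with X x in X-x | W x y in Wxy
  ... | false | _     = z≤n
  ... | true  | zero  = z≤n
  ... | true  | suc m rewrite closed x y X-x (cong positive Wxy) = ≤-refl

-- Birkhoff's theorem for natural number matrices, by induction on `k`: Hall's theorem on the
-- support of `W` yields a permutation `σ` inside it, and subtracting the matrix of `σ` lowers every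
-- line sum by one.
permutation-decomposition : ∀ {n} k (W : Fin n → Fin n → ℕ) →
  (∀ x → sum (W x) ≡ k) → (∀ y → sum (λ x → W x y) ≤ k) → PermutationDecomposition k W
permutation-decomposition zero W rowsW colsW = record
  { perm       = λ ()
  ; surjective = λ ()
  ; total      = λ x y → sym (n≤0⇒n≡0 (≤-trans (term≤sum (W x) y) (≤-reflexive (rowsW x))))
  }
permutation-decomposition {n} (suc k) W rowsW colsW = record
  { perm       = λ { zero → σ ; (suc i) → perm rest i }
  ; surjective = λ { zero → σ-surjective ; (suc i) → surjective rest i }
  ; total      = λ x y → trans (cong (δ (σ x) y +_) (total rest x y))
                           (trans (+-comm (δ (σ x) y) _) (decrement-+-δ (W x) (1≤W x) y))
  }
  where
  w : Flow (λ x y → positive (W x y)) (λ _ → 1) (λ _ → 1)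
  w = hall-flow _ _ _ ≤-refl (positive-HallCondition (suc k) W rowsW colsW)
  chosen : ∀ x → ∃ λ y → 1 ≤ amount w x y
  chosen x = sum-pos⇒∃ (amount w x) (≤-reflexive (sym (rows w x)))
  σ : Fin n → Fin n
  σ x = proj₁ (chosen x)
  1≤W : ∀ x → 1 ≤ W x (σ x)
  1≤W x = positive⇒1≤ (support⁻ w (proj₂ (chosen x)))
  hit≤1 : ∀ y → sum (λ x → δ (σ x) y) ≤ 1
  hit≤1 y = ≤-trans (sum-mono (λ x → δ≤ (amount w x) (proj₂ (chosen x)) y)) (columns w y)
  -- The `n` rows make `n` hits in all and no column takes more than one, so every column takes
  -- exactly one.
  σ-surjective : ∀ y → sum (λ x → δ (σ x) y) ≡ 1
  σ-surjective y = ≤-antisym (hit≤1 y) (sum-mono-≤⇒≥ hit≤1 (≤-reflexive (begin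
    sum {n} (λ _ → 1)                         ≡⟨ sum-cong-≗ (λ x → sum-δ (σ x)) ⟨
    sum (λ x → sum (λ y → δ (σ x) y))         ≡⟨ ∑-comm (λ x y → δ (σ x) y) ⟩
    sum (λ y → sum (λ x → δ (σ x) y))         ∎)) y)
    where open ≡-Reasoning
  W⁻ : Fin n → Fin n → ℕ
  W⁻ x = decrement (σ x) (W x)
  rest : PermutationDecomposition k W⁻
  rest = permutation-decomposition k W⁻
    (λ x → +-cancelʳ-≡ 1 _ _ (trans (sym (weight-decrement (λ _ → true) (W x) (1≤W x)))
                               (trans (rowsW x) (+-comm 1 k))))
    (λ y → +-cancelʳ-≤ 1 _ _ (begin
      sum (λ x → W⁻ x y) + 1                          ≡⟨ cong (sum (λ x → W⁻ x y) +_) (σ-surjective y) ⟨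
      sum (λ x → W⁻ x y) + sum (λ x → δ (σ x) y)      ≡⟨ ∑-distrib-+ (λ x → W⁻ x y) (λ x → δ (σ x) y) ⟨
      sum (λ x → W⁻ x y + δ (σ x) y)                  ≡⟨ sum-cong-≗ (λ x → decrement-+-δ (W x) (1≤W x) y) ⟩
      sum (λ x → W x y)                               ≤⟨ colsW y ⟩
      suc k                                           ≡⟨ +-comm 1 k ⟩
      k + 1                                           ∎))
    where open ≤-Reasoning

-- Balanced matchings in a normalized matching graph

sum-↑ : ∀ a {r} (f : Fin (a + r) → ℕ) →
  sum f ≡ sum (λ x → f (x ↑ˡ r)) + sum (λ z → f (a ↑ʳ z))
sum-↑ zero    f = refl
sum-↑ (suc a) f = trans (cong (f zero +_) (sum-↑ a (f ∘ suc))) (sym (+-assoc (f zero) _ _))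

∣∣≡weight : ∀ {n} (p : Subset n) → ∣ p ∣ ≡ weight (lookup p) (λ _ → 1)
∣∣≡weight []          = refl
∣∣≡weight (true  ∷ p) = cong suc (∣∣≡weight p)
∣∣≡weight (false ∷ p) = ∣∣≡weight p

anyFin⁻ : ∀ {n} (p : Fin n → Bool) → anyFin p ≡ true → ∃ λ i → p i ≡ true
anyFin⁻ {suc n} p any with p zero in p0
... | true  = zero , p0
... | false with anyFin⁻ (p ∘ suc) any
...   | i , pi = suc i , pi

-- Closedness puts the neighbourhood of `X` inside `Y`, so the normalized matching inequality is
-- Hall's condition for demands `b` and capacities `a`.
normalized-HallCondition : ∀ {a b} {E : BipGraph a b} → NormalizedMatching E →
  HallCondition E (λ _ → b) (λ _ → a)
normalized-HallCondition {a} {b} {E} normalized X Y closed = begin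
  weight X (λ _ → b)                              ≡⟨ weight-const X b ⟩
  b * weight X (λ _ → 1)                          ≡⟨ cong (b *_) (weight-cong _ (lookup∘tabulate X)) ⟨
  b * weight (lookup (tabulate X)) (λ _ → 1)      ≡⟨ cong (b *_) (∣∣≡weight (tabulate X)) ⟨
  b * ∣ tabulate X ∣                              ≡⟨ *-comm b _ ⟩
  ∣ tabulate X ∣ * b                              ≤⟨ normalized (tabulate X) ⟩
  ∣ Γ E (tabulate X) ∣ * a                        ≡⟨ *-comm _ a ⟩
  a * ∣ Γ E (tabulate X) ∣                        ≡⟨ cong (a *_) (∣∣≡weight (Γ E (tabulate X))) ⟩
  a * weight (lookup (Γ E (tabulate X))) (λ _ → 1) ≤⟨ *-monoʳ-≤ a (weight-⊆ _ Γ⊆Y) ⟩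
  a * weight Y (λ _ → 1)                          ≡⟨ weight-const Y a ⟨
  weight Y (λ _ → a)                              ∎
  where
  open ≤-Reasoning
  Γ⊆Y : ∀ y → lookup (Γ E (tabulate X)) y ≡ true → Y y ≡ true
  Γ⊆Y y y∈Γ with anyFin⁻ _ (trans (sym (lookup∘tabulate _ y)) y∈Γ)
  ... | x , both with lookup (tabulate X) x in X-x | E x y in Exy
  ...   | true | true = closed x y (trans (sym (lookup∘tabulate X x)) X-x) Exy

-- By injectivity the inner sums are 0 or 1, so `1 ∸ _` indicates that `y` is missed. The two bounds
-- are the multiplicities of the images and of their complements.
record BalancedMatchings {a b} (E : BipGraph a b) : Set where
  field
    matching  : Fin b → Fin a → Fin b
    edge      : ∀ i x → E x (matching i x) ≡ true
    injective : ∀ i {x x′} → matching i x ≡ matching i x′ → x ≡ x′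
    hits      : ∀ y → sum (λ i → sum (λ x → δ (matching i x) y)) ≤ a
    misses    : ∀ y → sum (λ i → 1 ∸ sum (λ x → δ (matching i x) y)) ≤ b ∸ a

-- The flow is completed to a square matrix by b ∸ a rows of ones.
balanced-matchings : ∀ a r (E : BipGraph a (a + r)) → NormalizedMatching E → BalancedMatchings E
balanced-matchings a r E normalized = record
  { matching  = f
  ; edge      = λ i x → support⁻ w (begin
      1                                     ≡⟨ δ-refl (f i x) ⟨
      δ (f i x) (f i x)                     ≤⟨ term≤sum (λ j → δ (f j x) (f i x)) i ⟩
      sum (λ j → δ (f j x) (f i x))         ≡⟨ total-w x (f i x) ⟩
      amount w x (f i x)                    ∎)
  ; injective = f-injective
  ; hits      = λ y → begin
      sum (λ i → sum (λ x → δ (f i x) y))   ≡⟨ ∑-comm (λ i x → δ (f i x) y) ⟩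
      sum (λ x → sum (λ i → δ (f i x) y))   ≡⟨ sum-cong-≗ (λ x → total-w x y) ⟩
      sum (λ x → amount w x y)              ≤⟨ columns w y ⟩
      a                                     ∎
  ; misses    = λ y → begin
      sum (λ i → 1 ∸ sum (λ x → δ (f i x) y))      ≡⟨ sum-cong-≗ (λ i → missed i y) ⟩
      sum (λ i → sum (λ z → δ (g i z) y))          ≡⟨ ∑-comm (λ i z → δ (g i z) y) ⟩
      sum (λ z → sum (λ i → δ (g i z) y))          ≡⟨ sum-cong-≗ (λ z → total-1 z y) ⟩
      sum {r} (λ _ → 1)                            ≡⟨ sum-const r 1 ⟩
      r * 1                                        ≡⟨ *-identityʳ r ⟩
      r                                            ≡⟨ m+n∸m≡n a r ⟨
      a + r ∸ a                                    ∎
  }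
  where
  open ≤-Reasoning
  b = a + r
  w : Flow E (λ _ → b) (λ _ → a)
  w = hall-flow _ _ _ ≤-refl (normalized-HallCondition normalized)
  W : Fin b → Fin b → ℕ
  W j y = [ (λ x → amount w x y) , (λ _ → 1) ]′ (splitAt a j)
  W-↑ˡ : ∀ x y → W (x ↑ˡ r) y ≡ amount w x y
  W-↑ˡ x y = cong [ (λ x → amount w x y) , (λ _ → 1) ]′ (splitAt-↑ˡ a x r)
  W-↑ʳ : ∀ z y → W (a ↑ʳ z) y ≡ 1
  W-↑ʳ z y = cong [ (λ x → amount w x y) , (λ _ → 1) ]′ (splitAt-↑ʳ a r z)
  W-rows : ∀ j → sum (W j) ≡ b
  W-rows j with splitAt a j
  ... | inj₁ x = rows w x
  ... | inj₂ z = trans (sum-const b 1) (*-identityʳ b)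
  W-columns : ∀ y → sum (λ j → W j y) ≤ b
  W-columns y = begin
    sum (λ j → W j y)                                            ≡⟨ sum-↑ a (λ j → W j y) ⟩
    sum (λ x → W (x ↑ˡ r) y) + sum {r} (λ z → W (a ↑ʳ z) y)      ≡⟨ cong₂ _+_ (sum-cong-≗ (λ x → W-↑ˡ x y)) (sum-cong-≗ (λ z → W-↑ʳ z y)) ⟩
    sum (λ x → amount w x y) + sum {r} (λ _ → 1)                 ≤⟨ +-mono-≤ (columns w y) (≤-reflexive (trans (sum-const r 1) (*-identityʳ r))) ⟩
    a + r                                                        ∎
  D = permutation-decomposition b W W-rows W-columns
  f : Fin b → Fin a → Fin b
  f i x = perm D i (x ↑ˡ r)
  g : Fin b → Fin r → Fin b
  g i z = perm D i (a ↑ʳ z)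
  total-w : ∀ x y → sum (λ i → δ (f i x) y) ≡ amount w x y
  total-w x y = trans (total D (x ↑ˡ r) y) (W-↑ˡ x y)
  total-1 : ∀ z y → sum (λ i → δ (g i z) y) ≡ 1
  total-1 z y = trans (total D (a ↑ʳ z) y) (W-↑ʳ z y)
  -- The `i`-th permutation hits `y` exactly once, either from the first `a` rows or from the `r`
  -- added ones.
  missed : ∀ i y → 1 ∸ sum (λ x → δ (f i x) y) ≡ sum (λ z → δ (g i z) y)
  missed i y = trans
    (cong (_∸ sum (λ x → δ (f i x) y))
      (trans (sym (surjective D i y)) (sum-↑ a (λ j → δ (perm D i j) y))))
    (m+n∸m≡n (sum (λ x → δ (f i x) y)) _)
  f-injective : ∀ i {x x′} → f i x ≡ f i x′ → x ≡ x′
  f-injective i {x} {x′} fx≡fx′ with x ≟ x′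
  ... | yes x≡x′ = x≡x′
  -- Two rows with a common value would hit that column twice.
  ... | no x≢x′  = contradiction (begin
    2                                                  ≡⟨ cong₂ _+_ (δ-refl (f i x)) (δ-refl (f i x)) ⟨
    δ (f i x) (f i x) + δ (f i x) (f i x)              ≡⟨ cong (λ z → δ (f i x) (f i x) + δ z (f i x)) fx≡fx′ ⟩
    δ (f i x) (f i x) + δ (f i x′) (f i x)             ≤⟨ two-terms≤sum (λ j → δ (perm D i j) (f i x)) (x≢x′ ∘ ↑ˡ-injective r x x′) ⟩
    sum (λ j → δ (perm D i j) (f i x))                 ≡⟨ surjective D i (f i x) ⟩
    1                                                  ∎) (λ { (s≤s ()) })

open BalancedMatchings

-- Binomial coefficients

nC0≡1 : ∀ n → n C 0 ≡ 1
nC0≡1 n = trans (nCk≡nC[n∸k] {0} {n} z≤n) (nCn≡1 n)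

nCk≤2^n : ∀ n k → n C k ≤ 2 ^ n
nCk≤2^n n       zero    = ≤-trans (≤-reflexive (nC0≡1 n)) (m^n>0 2 n)
nCk≤2^n zero    (suc k) = ≤-trans (≤-reflexive (k>n⇒nCk≡0 {0} {suc k} (s≤s z≤n))) z≤n
nCk≤2^n (suc n) (suc k) = begin
  suc n C suc k          ≡⟨ nCk+nC[k+1]≡[n+1]C[k+1] n k ⟨
  n C k + n C suc k      ≤⟨ +-mono-≤ (nCk≤2^n n k) (nCk≤2^n n (suc k)) ⟩
  2 ^ n + 2 ^ n          ≡⟨ cong (2 ^ n +_) (+-identityʳ (2 ^ n)) ⟨
  2 ^ suc n              ∎
  where open ≤-Reasoning

[d+e]Cd*d!*e! : ∀ d e → ((d + e) C d) * (d ! * e !) ≡ (d + e) !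
[d+e]Cd*d!*e! d e = begin
  ((d + e) C d) * (d ! * e !)                                          ≡⟨ cong (λ k → ((d + e) C d) * (d ! * k !)) (m+n∸m≡n d e) ⟨
  ((d + e) C d) * (d ! * (d + e ∸ d) !)                                ≡⟨ cong (_* (d ! * (d + e ∸ d) !)) (nCk≡n!/k![n-k]! (m≤m+n d e)) ⟩
  ((d + e) ! / (d ! * (d + e ∸ d) !)) * (d ! * (d + e ∸ d) !)        ≡⟨ m/n*n≡m (k![n∸k]!∣n! (m≤m+n d e)) ⟩
  (d + e) !                                                          ∎
  where
  open ≡-Reasoning
  instance
    _ = d !* (d + e ∸ d) !≢0

-- Both sides times `d ! * e !` equal `suc (d + e) !`.
[1+d+e]Cd*[1+e] : ∀ d e → (suc (d + e) C d) * suc e ≡ suc (d + e) * ((d + e) C d)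
[1+d+e]Cd*[1+e] d e = *-cancelʳ-≡ _ _ (d ! * e !) (begin
  (suc (d + e) C d) * suc e * (d ! * e !)       ≡⟨ solve 4 (λ c s p q → c :* s :* (p :* q) := c :* (p :* (s :* q))) refl (suc (d + e) C d) (suc e) (d !) (e !) ⟩
  (suc (d + e) C d) * (d ! * suc e !)           ≡⟨ cong (λ n → (n C d) * (d ! * suc e !)) (+-suc d e) ⟨
  ((d + suc e) C d) * (d ! * suc e !)           ≡⟨ [d+e]Cd*d!*e! d (suc e) ⟩
  (d + suc e) !                               ≡⟨ cong _! (+-suc d e) ⟩
  suc (d + e) * (d + e) !                     ≡⟨ cong (suc (d + e) *_) ([d+e]Cd*d!*e! d e) ⟨
  suc (d + e) * (((d + e) C d) * (d ! * e !))   ≡⟨ *-assoc (suc (d + e)) ((d + e) C d) (d ! * e !) ⟨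
  suc (d + e) * ((d + e) C d) * (d ! * e !)     ∎)
  where
  open ≡-Reasoning
  open +-*-Solver
  instance
    _ = d !* e !≢0

^-distribʳ-* : ∀ k m n → (m * n) ^ k ≡ m ^ k * n ^ k
^-distribʳ-* zero    m n = refl
^-distribʳ-* (suc k) m n = trans (cong (m * n *_) (^-distribʳ-* k m n))
  (solve 4 (λ m n p q → m :* n :* (p :* q) := m :* p :* (n :* q)) refl m n (m ^ k) (n ^ k))
  where open +-*-Solver

-- Bernoulli's inequality 1 + m/b ≤ (1 + 1/b)^m, cleared of denominators.
bernoulli : ∀ b m → b ^ m * (b + m) ≤ b * suc b ^ m
bernoulli b zero    = ≤-reflexive (trans (+-identityʳ _) (trans (+-identityʳ b) (sym (*-identityʳ b))))
bernoulli b (suc m) = begin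
  b * b ^ m * (b + suc m)            ≡⟨ solve 3 (λ b p m → b :* p :* (b :+ (con 1 :+ m)) := p :* (b :+ m) :* b :+ p :* b) refl b (b ^ m) m ⟩
  b ^ m * (b + m) * b + b ^ m * b         ≤⟨ +-monoʳ-≤ (b ^ m * (b + m) * b) (*-monoʳ-≤ (b ^ m) (m≤m+n b m)) ⟩
  b ^ m * (b + m) * b + b ^ m * (b + m)   ≡⟨ solve 2 (λ q b → q :* b :+ q := q :* (con 1 :+ b)) refl (b ^ m * (b + m)) b ⟩
  b ^ m * (b + m) * suc b            ≤⟨ *-monoˡ-≤ (suc b) (bernoulli b m) ⟩
  b * suc b ^ m * suc b              ≡⟨ solve 3 (λ b q s → b :* q :* s := b :* (s :* q)) refl b (suc b ^ m) (suc b) ⟩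
  b * (suc b * suc b ^ m)            ∎
  where
  open ≤-Reasoning
  open +-*-Solver

-- From `b` to `suc b` the binomial coefficient grows by the factor (b+1)/(b-d+1), which must not
-- exceed (1 + 1/b)^2d. By Bernoulli's inequality a quadratic comparison suffices.
power-growth : ∀ d t .{{_ : NonZero d}} → let b = d + (d + t) in
  suc b * b ^ (d + d) ≤ suc b ^ (d + d) * suc (d + t)
power-growth d@(suc _) t = *-cancelˡ-≤ b (begin
  b * (suc b * b ^ m)               ≡⟨ solve 3 (λ b s p → b :* (s :* p) := p :* (b :* s)) refl b (suc b) (b ^ m) ⟩
  b ^ m * (b * suc b)               ≤⟨ *-monoʳ-≤ (b ^ m) quadratic ⟩
  b ^ m * ((b + m) * suc e)         ≡⟨ *-assoc (b ^ m) _ _ ⟨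
  b ^ m * (b + m) * suc e           ≤⟨ *-monoˡ-≤ (suc e) (bernoulli b m) ⟩
  b * suc b ^ m * suc e             ≡⟨ *-assoc b (suc b ^ m) (suc e) ⟩
  b * (suc b ^ m * suc e)           ∎)
  where
  open ≤-Reasoning
  open +-*-Solver
  e = d + t
  b = d + e
  m = d + d
  quadratic : b * suc b ≤ (b + m) * suc e
  quadratic = begin
    -- The added term is exactly the difference of the two sides.
    b * suc b                       ≤⟨ m≤m+n _ (d * t + d + d) ⟩
    b * suc b + (d * t + d + d)     ≡⟨ solve 2 (λ d t → let b = d :+ (d :+ t) in
                                         b :* (con 1 :+ b) :+ (d :* t :+ d :+ d) := (b :+ (d :+ d)) :* (con 1 :+ (d :+ t)))
                                         refl d t ⟩
    (b + m) * suc e                 ∎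

-- Induction on `t`, the excess of `b` over 2d. At `t = 0` the crude bound 2^2d on the central
-- coefficient is enough; `power-growth` compares the growth of the two sides.
nCd*d^2d≤n^2d : ∀ d t .{{_ : NonZero d}} → let b = d + (d + t) in (b C d) * d ^ (d + d) ≤ b ^ (d + d)
nCd*d^2d≤n^2d d zero rewrite +-identityʳ d = begin
  ((d + d) C d) * d ^ (d + d)   ≤⟨ *-monoˡ-≤ (d ^ (d + d)) (nCk≤2^n (d + d) d) ⟩
  2 ^ (d + d) * d ^ (d + d)     ≡⟨ ^-distribʳ-* (d + d) 2 d ⟨
  (2 * d) ^ (d + d)             ≡⟨ cong (λ k → (d + k) ^ (d + d)) (+-identityʳ d) ⟩
  (d + d) ^ (d + d)             ∎
  where open ≤-Reasoning
nCd*d^2d≤n^2d d (suc t) rewrite +-suc d t | +-suc d (d + t) = *-cancelʳ-≤ _ _ (suc e) (begin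
  (suc b C d) * D * suc e         ≡⟨ solve 3 (λ c D e → c :* D :* e := c :* e :* D) refl (suc b C d) D (suc e) ⟩
  (suc b C d) * suc e * D         ≡⟨ cong (_* D) ([1+d+e]Cd*[1+e] d e) ⟩
  suc b * (b C d) * D             ≡⟨ *-assoc (suc b) (b C d) D ⟩
  suc b * ((b C d) * D)           ≤⟨ *-monoʳ-≤ (suc b) (nCd*d^2d≤n^2d d t) ⟩
  suc b * b ^ (d + d)           ≤⟨ power-growth d t ⟩
  suc b ^ (d + d) * suc e       ∎)
  where
  open ≤-Reasoning
  open +-*-Solver
  e = d + t
  b = d + e
  D = d ^ (d + d)

-- Squaring the hypothesis brings in b^2d, which dominates `b C d` times d^2d; then d^2d cancels.
-- For `d = 0` the hypothesis itself says that `N` is positive.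
C≤square : ∀ d b N → d + d ≤ b → b ^ d ≤ N * d ^ d → b C d ≤ N * N
C≤square zero b N _ 1≤N*1 = ≤-trans (≤-reflexive (nC0≡1 b)) (*-mono-≤ 1≤N 1≤N)
  where
  1≤N : 1 ≤ N
  1≤N = ≤-trans 1≤N*1 (≤-reflexive (*-identityʳ N))
C≤square d@(suc _) b N 2d≤b b^d≤ with m≤n⇒∃[o]m+o≡n 2d≤b
... | t , refl = *-cancelʳ-≤ _ _ (d ^ (d + d)) {{m^n≢0 d (d + d)}} (begin
  (b C d) * d ^ (d + d)              ≤⟨ subst (λ n → (n C d) * d ^ (d + d) ≤ n ^ (d + d)) (sym (+-assoc d d t)) (nCd*d^2d≤n^2d d t) ⟩
  b ^ (d + d)                      ≡⟨ ^-distribˡ-+-* b d d ⟩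
  b ^ d * b ^ d                    ≤⟨ *-mono-≤ b^d≤ b^d≤ ⟩
  N * d ^ d * (N * d ^ d)          ≡⟨ solve 2 (λ N p → N :* p :* (N :* p) := N :* N :* (p :* p)) refl N (d ^ d) ⟩
  N * N * (d ^ d * d ^ d)          ≡⟨ cong (N * N *_) (^-distribˡ-+-* d d d) ⟨
  N * N * d ^ (d + d)              ∎)
  where
  open ≤-Reasoning
  open +-*-Solver

-- Counting the members of a set family with the basis exchange property

gain : Bool → Bool → ℕ → ℕ
gain true  true  c = 1
gain true  false c = 0
gain false true  c = c
gain false false c = 1

-- The product of c over D outside S, or 0 unless S ⊆ D.
extension : ∀ {n} → Subset n → Subset n → Vec ℕ n → ℕ
extension []      []      []       = 1
extension (s ∷ S) (d ∷ D) (c ∷ cs) = gain s d c * extension S D cs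

extensions : ∀ {n} → List (Subset n) → Subset n → Vec ℕ n → ℕ
extensions []      S c = 0
extensions (D ∷ L) S c = extension S D c + extensions L S c

missing : ∀ {n} → Subset n → Subset n → ℕ
missing []          []          = 0
missing (true  ∷ S) (d     ∷ D) = missing S D
missing (false ∷ S) (true  ∷ D) = suc (missing S D)
missing (false ∷ S) (false ∷ D) = missing S D

bump : ∀ {n} → Subset n → Subset n → Vec ℕ n → Vec ℕ n
bump []          []          []       = []
bump (true  ∷ S) (d     ∷ D) (c ∷ cs) = c ∷ bump S D cs
bump (false ∷ S) (true  ∷ D) (c ∷ cs) = suc c ∷ bump S D cs
bump (false ∷ S) (false ∷ D) (c ∷ cs) = c ∷ bump S D cs

-- `Φ S` is affine in the weight of each `e` outside `S`, and its slope there is `Φ` with `e` forced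
-- into the set.
Additive : ∀ {n} → (Subset n → Vec ℕ n → ℕ) → Set
Additive Φ = ∀ S c e → lookup S e ≡ false → Φ S (c [ e ]%= suc) ≡ Φ S c + Φ (S [ e ]≔ true) c

extension-additive : ∀ {n} (D : Subset n) → Additive (λ S → extension S D)
extension-additive (true  ∷ D) (false ∷ S) (c ∷ cs) zero refl =
  trans (+-comm _ (c * extension S D cs)) (cong (c * extension S D cs +_) (sym (+-identityʳ _)))
extension-additive (false ∷ D) (false ∷ S) (c ∷ cs) zero refl = sym (+-identityʳ _)
extension-additive (d ∷ D) (s ∷ S) (c ∷ cs) (suc e) e∉S =
  trans (cong (gain s d c *_) (extension-additive D S cs e e∉S)) (*-distribˡ-+ (gain s d c) _ _)

extensions-additive : ∀ {n} (L : List (Subset n)) → Additive (extensions L)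
extensions-additive []      S c e e∉S = refl
extensions-additive (D ∷ L) S c e e∉S =
  trans (cong₂ _+_ (extension-additive D S c e e∉S) (extensions-additive L S c e e∉S))
        (solve 4 (λ p q x y → p :+ q :+ (x :+ y) := p :+ x :+ (q :+ y)) refl
          (extension S D c) (extension (S [ e ]≔ true) D c) (extensions L S c) (extensions L (S [ e ]≔ true) c))
  where open +-*-Solver

gain-mono : ∀ s d {m n} → m ≤ n → gain s d m ≤ gain s d n
gain-mono true  true  m≤n = ≤-refl
gain-mono true  false m≤n = ≤-refl
gain-mono false true  m≤n = m≤n
gain-mono false false m≤n = ≤-refl

extension-mono : ∀ {n} (S D : Subset n) {c c′} → (∀ e → lookup c e ≤ lookup c′ e) →
  extension S D c ≤ extension S D c′
extension-mono []      []      {[]}    {[]}    c≤c′ = ≤-refl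
extension-mono (s ∷ S) (d ∷ D) {_ ∷ _} {_ ∷ _} c≤c′ =
  *-mono-≤ (gain-mono s d (c≤c′ zero)) (extension-mono S D (c≤c′ ∘ suc))

extensions-mono : ∀ {n} L (S : Subset n) {c c′} → (∀ e → lookup c e ≤ lookup c′ e) →
  extensions L S c ≤ extensions L S c′
extensions-mono []      S c≤c′ = ≤-refl
extensions-mono (D ∷ L) S c≤c′ = +-mono-≤ (extension-mono S D c≤c′) (extensions-mono L S c≤c′)

extension≤extensions : ∀ {n L} {S D : Subset n} c → D ∈ₗ L → extension S D c ≤ extensions L S c
extension≤extensions c (here refl) = m≤m+n _ _
extension≤extensions c (there D∈L) = ≤-trans (extension≤extensions c D∈L) (m≤n+m _ _)

-- By additivity Φ S (bump S D c) is the sum of Φ S′ c over S ⊆ S′ ⊆ D.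
additive-expansion : ∀ {n} (Φ : Subset n → Vec ℕ n → ℕ) → Additive Φ → ∀ m q S D c → S ⊆ D →
  (∀ S′ → S′ ⊆ D → m * q ^ missing S′ D ≤ Φ S′ c) →
  m * suc q ^ missing S D ≤ Φ S (bump S D c)
additive-expansion Φ additive m q [] [] [] S⊆D bound = bound [] S⊆D
additive-expansion Φ additive m q (true ∷ S) (true ∷ D) (c ∷ cs) S⊆D bound =
  additive-expansion (λ S′ cs′ → Φ (true ∷ S′) (c ∷ cs′))
    (λ S′ cs′ e → additive (true ∷ S′) (c ∷ cs′) (suc e))
    m q S D cs (drop-∷-⊆ S⊆D) (λ S′ S′⊆D → bound (true ∷ S′) (s⊆s S′⊆D))
additive-expansion Φ additive m q (true ∷ S) (false ∷ D) (c ∷ cs) S⊆D bound with S⊆D here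
... | ()
additive-expansion Φ additive m q (false ∷ S) (false ∷ D) (c ∷ cs) S⊆D bound =
  additive-expansion (λ S′ cs′ → Φ (false ∷ S′) (c ∷ cs′))
    (λ S′ cs′ e → additive (false ∷ S′) (c ∷ cs′) (suc e))
    m q S D cs (drop-∷-⊆ S⊆D) (λ S′ S′⊆D → bound (false ∷ S′) (s⊆s S′⊆D))
additive-expansion Φ additive m q (false ∷ S) (true ∷ D) (c ∷ cs) S⊆D bound = begin
  -- As in the binomial theorem, the head element is either left out of `S′`, which costs a factor
  -- `q` collected in `m`, or put into it at no cost.
  m * (suc q * Q)                               ≡⟨ solve 3 (λ m q Q → m :* ((con 1 :+ q) :* Q) := m :* q :* Q :+ m :* Q) refl m q Q ⟩
  m * q * Q + m * Q                             ≤⟨ +-mono-≤ without with-head ⟩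
  Φ (false ∷ S) (c ∷ cs⁺) + Φ (true ∷ S) (c ∷ cs⁺)  ≡⟨ additive (false ∷ S) (c ∷ cs⁺) zero refl ⟨
  Φ (false ∷ S) (suc c ∷ cs⁺)                   ∎
  where
  open ≤-Reasoning
  open +-*-Solver
  Q = suc q ^ missing S D
  cs⁺ = bump S D cs
  without : m * q * Q ≤ Φ (false ∷ S) (c ∷ cs⁺)
  without = additive-expansion (λ S′ cs′ → Φ (false ∷ S′) (c ∷ cs′))
    (λ S′ cs′ e → additive (false ∷ S′) (c ∷ cs′) (suc e))
    (m * q) q S D cs (drop-∷-⊆ S⊆D)
    (λ S′ S′⊆D → ≤-trans (≤-reflexive (*-assoc m q _)) (bound (false ∷ S′) (out⊆ S′⊆D)))
  with-head : m * Q ≤ Φ (true ∷ S) (c ∷ cs⁺)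
  with-head = additive-expansion (λ S′ cs′ → Φ (true ∷ S′) (c ∷ cs′))
    (λ S′ cs′ e → additive (true ∷ S′) (c ∷ cs′) (suc e))
    m q S D cs (drop-∷-⊆ S⊆D) (λ S′ S′⊆D → bound (true ∷ S′) (s⊆s S′⊆D))

-- The left side vanishes unless `S` equals `D`, and then both sides are 1.
0^missing≤extension : ∀ {n} (S D : Subset n) c → S ⊆ D → 0 ^ missing S D ≤ extension S D c
0^missing≤extension []          []          []       S⊆D = ≤-refl
0^missing≤extension (true  ∷ S) (true  ∷ D) (c ∷ cs) S⊆D =
  ≤-trans (0^missing≤extension S D cs (drop-∷-⊆ S⊆D)) (m≤m+n _ 0)
0^missing≤extension (true  ∷ S) (false ∷ D) (c ∷ cs) S⊆D with S⊆D here
... | ()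
0^missing≤extension (false ∷ S) (true  ∷ D) (c ∷ cs) S⊆D = z≤n
0^missing≤extension (false ∷ S) (false ∷ D) (c ∷ cs) S⊆D =
  ≤-trans (0^missing≤extension S D cs (drop-∷-⊆ S⊆D)) (m≤m+n _ 0)

∣S∣+missing : ∀ {n} (S D : Subset n) → S ⊆ D → ∣ S ∣ + missing S D ≡ ∣ D ∣
∣S∣+missing []          []          S⊆D = refl
∣S∣+missing (true  ∷ S) (true  ∷ D) S⊆D = cong suc (∣S∣+missing S D (drop-∷-⊆ S⊆D))
∣S∣+missing (true  ∷ S) (false ∷ D) S⊆D with S⊆D here
... | ()
∣S∣+missing (false ∷ S) (true  ∷ D) S⊆D = trans (+-suc ∣ S ∣ _) (cong suc (∣S∣+missing S D (drop-∷-⊆ S⊆D)))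
∣S∣+missing (false ∷ S) (false ∷ D) S⊆D = ∣S∣+missing S D (drop-∷-⊆ S⊆D)

extension-⊥≤ : ∀ {n} (D : Subset n) c m → (∀ e → lookup c e ≤ m) → extension ⊥ D c ≤ m ^ ∣ D ∣
extension-⊥≤ []          []       m c≤m = ≤-refl
extension-⊥≤ (true  ∷ D) (c ∷ cs) m c≤m = *-mono-≤ (c≤m zero) (extension-⊥≤ D cs m (c≤m ∘ suc))
extension-⊥≤ (false ∷ D) (c ∷ cs) m c≤m =
  ≤-trans (≤-reflexive (+-identityʳ _)) (extension-⊥≤ D cs m (c≤m ∘ suc))

extensions-⊥≤ : ∀ {n} (L : List (Subset n)) c m d → (∀ e → lookup c e ≤ m) →
  (∀ {D} → D ∈ₗ L → ∣ D ∣ ≡ d) → extensions L ⊥ c ≤ length L * m ^ d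
extensions-⊥≤ []      c m d c≤m size = z≤n
extensions-⊥≤ (D ∷ L) c m d c≤m size = +-mono-≤
  (≤-trans (extension-⊥≤ D c m c≤m) (≤-reflexive (cong (m ^_) (size (here refl)))))
  (extensions-⊥≤ L c m d c≤m (size ∘ there))

add-indicator : ∀ {n} → Subset n → Vec ℕ n → Vec ℕ n
add-indicator = zipWith (λ p c → select p 1 + c)

-- An element raised by `bump` lies in `D` but not in `S`, hence in `B`.
bump≤add-indicator : ∀ {n} (S D B : Subset n) c → D ⊆ S ∪ B →
  ∀ e → lookup (bump S D c) e ≤ lookup (add-indicator B c) e
bump≤add-indicator (true  ∷ S) (d ∷ D)    (p ∷ B)     (c ∷ cs) D⊆ zero = m≤n+m c _
bump≤add-indicator (false ∷ S) (true ∷ D) (true  ∷ B) (c ∷ cs) D⊆ zero = ≤-refl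
bump≤add-indicator (false ∷ S) (true ∷ D) (false ∷ B) (c ∷ cs) D⊆ zero with D⊆ here
... | ()
bump≤add-indicator (false ∷ S) (false ∷ D) (p ∷ B)    (c ∷ cs) D⊆ zero = m≤n+m c _
bump≤add-indicator (true  ∷ S) (d ∷ D)     (p ∷ B)    (c ∷ cs) D⊆ (suc e) =
  bump≤add-indicator S D B cs (drop-∷-⊆ D⊆) e
bump≤add-indicator (false ∷ S) (true ∷ D)  (p ∷ B)    (c ∷ cs) D⊆ (suc e) =
  bump≤add-indicator S D B cs (drop-∷-⊆ D⊆) e
bump≤add-indicator (false ∷ S) (false ∷ D) (p ∷ B)    (c ∷ cs) D⊆ (suc e) =
  bump≤add-indicator S D B cs (drop-∷-⊆ D⊆) e

multiplicity : ∀ {n k} → (Fin k → Subset n) → Vec ℕ n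
multiplicity {n} {zero}  B = replicate n 0
multiplicity {n} {suc k} B = add-indicator (B zero) (multiplicity (B ∘ suc))

lookup-multiplicity : ∀ {n} k (B : Fin k → Subset n) e →
  lookup (multiplicity B) e ≡ sum (λ i → select (lookup (B i) e) 1)
lookup-multiplicity zero    B e = lookup-replicate e 0
lookup-multiplicity (suc k) B e = trans (lookup-zipWith _ e (B zero) (multiplicity (B ∘ suc)))
  (cong (select (lookup (B zero) e) 1 +_) (lookup-multiplicity k (B ∘ suc) e))

-- The matroid property in the form used for counting: an independent set `S`, witnessed by `D`,
-- extends to a basis inside its union with any prescribed basis `B`.
record Exchange {n} (L : List (Subset n)) : Set where
  field
    rank     : ℕ
    size     : ∀ {D} → D ∈ₗ L → ∣ D ∣ ≡ rank
    exchange : ∀ {S B D} → D ∈ₗ L → S ⊆ D → B ∈ₗ L → ∃ λ D′ → D′ ∈ₗ L × S ⊆ D′ × D′ ⊆ S ∪ B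

open Exchange

-- Induction on the number of bases. Exchange with `B zero` gives a basis `D′` whose part outside
-- `S` lies in `B zero`. Raising the weights on this part expands the weighted count over all `S′`
-- between `S` and `D′`; the induction hypothesis bounds each summand, and the binomial theorem adds
-- these bounds up to a power of `suc k`.
k^missing≤extensions : ∀ {n L} → Exchange {n} L → ∀ k (B : Fin k → Subset n) → (∀ i → B i ∈ₗ L) →
  ∀ {S D} → D ∈ₗ L → S ⊆ D → k ^ missing S D ≤ extensions L S (multiplicity B)
k^missing≤extensions ex zero B B∈L {S} {D} D∈L S⊆D =
  ≤-trans (0^missing≤extension S D _ S⊆D) (extension≤extensions _ D∈L)
k^missing≤extensions {L = L} ex (suc k) B B∈L {S} {D} D∈L S⊆D with exchange ex D∈L S⊆D (B∈L zero)
... | D′ , D′∈L , S⊆D′ , D′⊆S∪B = begin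
  suc k ^ missing S D                    ≡⟨ cong (suc k ^_) same-missing ⟩
  suc k ^ missing S D′                   ≡⟨ +-identityʳ _ ⟨
  1 * suc k ^ missing S D′               ≤⟨ additive-expansion (extensions L) (extensions-additive L) 1 k S D′ c S⊆D′
                                              (λ S′ S′⊆D′ → ≤-trans (≤-reflexive (+-identityʳ _))
                                                (k^missing≤extensions ex k (B ∘ suc) (B∈L ∘ suc) D′∈L S′⊆D′)) ⟩
  extensions L S (bump S D′ c)           ≤⟨ extensions-mono L S (bump≤add-indicator S D′ (B zero) c D′⊆S∪B) ⟩
  extensions L S (multiplicity B)        ∎
  where
  open ≤-Reasoning
  c = multiplicity (B ∘ suc)
  same-missing : missing S D ≡ missing S D′
  same-missing = +-cancelˡ-≡ ∣ S ∣ _ _ (trans (∣S∣+missing S D S⊆D)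
    (trans (size ex D∈L) (trans (sym (size ex D′∈L)) (sym (∣S∣+missing S D′ S⊆D′)))))

-- The total weight over the empty set is bounded from both sides: a single member weighs at most
-- `m ^ rank ex`.
exchange-count : ∀ {n L} (ex : Exchange {n} L) {D} → D ∈ₗ L → ∀ k (B : Fin k → Subset n) m →
  (∀ i → B i ∈ₗ L) → (∀ e → sum (λ i → select (lookup (B i) e) 1) ≤ m) →
  k ^ rank ex ≤ length L * m ^ rank ex
exchange-count {n} {L} ex {D} D∈L k B m B∈L B≤m = begin
  k ^ rank ex                            ≡⟨ cong (k ^_) rank≡missing ⟩
  k ^ missing ⊥ D                        ≤⟨ k^missing≤extensions ex k B B∈L D∈L ⊥⊆D ⟩
  extensions L ⊥ (multiplicity B)        ≤⟨ extensions-⊥≤ L _ m (rank ex)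
                                              (λ e → ≤-trans (≤-reflexive (lookup-multiplicity k B e)) (B≤m e)) (size ex) ⟩
  length L * m ^ rank ex                 ∎
  where
  open ≤-Reasoning
  ⊥⊆D : ⊥ ⊆ D
  ⊥⊆D = ⊥⊆
  rank≡missing : rank ex ≡ missing ⊥ D
  rank≡missing = trans (sym (size ex D∈L)) (trans (sym (∣S∣+missing ⊥ D ⊥⊆D)) (cong (_+ missing ⊥ D) (∣⊥∣≡0 n)))

-- Matchable sets

record IsMatching {a b} (E : BipGraph a b) (v : Vec (Fin b) a) : Set where
  constructor mkMatching
  field
    adjacent : ∀ x → E x (lookup v x) ≡ true
    distinct : ∀ {x x′} → lookup v x ≡ lookup v x′ → x ≡ x′

open IsMatching

matchings : ∀ {a b} → BipGraph a b → List (Vec (Fin b) a)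
matchings {a} {b} E = filter (λ v → isCompleteMatching E v ≟ᵇ true) (allVecs a b)

allFin⁺ : ∀ {n} (p : Fin n → Bool) → (∀ i → p i ≡ true) → allFin p ≡ true
allFin⁺ {zero}  p all = refl
allFin⁺ {suc n} p all = cong₂ _∧_ (all zero) (allFin⁺ (p ∘ suc) (all ∘ suc))

∧-true⁻ : ∀ {p q} → p ∧ q ≡ true → p ≡ true × q ≡ true
∧-true⁻ {true} {true} _ = refl , refl

allFin⁻ : ∀ {n} (p : Fin n → Bool) → allFin p ≡ true → ∀ i → p i ≡ true
allFin⁻ p all zero    = proj₁ (∧-true⁻ all)
allFin⁻ p all (suc i) = allFin⁻ (p ∘ suc) (proj₂ (∧-true⁻ {p zero} all)) i

matchings-sound : ∀ {a b} (E : BipGraph a b) {v} → v ∈ₗ matchings E → IsMatching E v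
matchings-sound {a} {b} E {v} v∈ = mkMatching (allFin⁻ _ (proj₁ tests))
  (λ {x} {x′} → separate x x′ (allFin⁻ _ (allFin⁻ _ (proj₂ tests) x) x′))
  where
  tests = ∧-true⁻ (proj₂ (∈-filter⁻ (λ v → isCompleteMatching E v ≟ᵇ true) {xs = allVecs a b} v∈))
  separate : ∀ x x′ → ⌊ x ≟ x′ ⌋ ∨ not ⌊ lookup v x ≟ lookup v x′ ⌋ ≡ true →
    lookup v x ≡ lookup v x′ → x ≡ x′
  separate x x′ test eq with x ≟ x′ | lookup v x ≟ lookup v x′
  ... | yes x≡x′ | _      = x≡x′
  ... | no _     | no neq = contradiction eq neq

matchings-complete : ∀ {a b} (E : BipGraph a b) {v} → IsMatching E v → v ∈ₗ matchings E
matchings-complete {a} {b} E {v} match =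
  ∈-filter⁺ (λ v → isCompleteMatching E v ≟ᵇ true) (∈-allVecs a b v)
    (cong₂ _∧_ (allFin⁺ _ (adjacent match)) (allFin⁺ _ (λ x → allFin⁺ _ (λ x′ → separate x x′))))
  where
  separate : ∀ x x′ → ⌊ x ≟ x′ ⌋ ∨ not ⌊ lookup v x ≟ lookup v x′ ⌋ ≡ true
  separate x x′ with x ≟ x′ | lookup v x ≟ lookup v x′
  ... | yes _   | _      = refl
  ... | no _    | no _   = refl
  ... | no x≢x′ | yes eq = contradiction (distinct match eq) x≢x′

image : ∀ {a b} → Vec (Fin b) a → Subset b
image []      = ⊥
image (y ∷ v) = ⁅ y ⁆ ∪ image v

lookup∈image : ∀ {a b} (v : Vec (Fin b) a) x → lookup v x ∈ image v
lookup∈image (y ∷ v) zero    = x∈p∪q⁺ (inj₁ (x∈⁅x⁆ y))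
lookup∈image (y ∷ v) (suc x) = x∈p∪q⁺ (inj₂ (lookup∈image v x))

image⁻ : ∀ {a b} (v : Vec (Fin b) a) {y} → y ∈ image v → ∃ λ x → lookup v x ≡ y
image⁻ []      y∈ = ⊥-elim (∉⊥ y∈)
image⁻ (z ∷ v) y∈ with x∈p∪q⁻ ⁅ z ⁆ (image v) y∈
... | inj₁ y∈⁅z⁆ = zero , sym (x∈⁅y⁆⇒x≡y z y∈⁅z⁆)
... | inj₂ y∈v with image⁻ v y∈v
...   | x , eq = suc x , eq

select-∈ : ∀ {n} {p : Subset n} {e} → e ∈ p → select (lookup p e) 1 ≡ 1
select-∈ e∈p = cong (λ q → select q 1) ([]=⇒lookup e∈p)

select-∉ : ∀ {n} (p : Subset n) e → e ∉ p → select (lookup p e) 1 ≡ 0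
select-∉ p e e∉p with lookup p e in eq
... | true  = contradiction (lookup⇒[]= e p eq) e∉p
... | false = refl

sum-δ-injective : ∀ {a b} (f : Fin a → Fin b) → (∀ {x x′} → f x ≡ f x′ → x ≡ x′) →
  ∀ y → sum (λ x → δ (f x) y) ≤ 1
sum-δ-injective {zero}  f inj y = z≤n
sum-δ-injective {suc _} f inj y with f zero ≟ y
... | yes refl = ≤-reflexive (cong₂ _+_ (δ-refl (f zero))
  (sum-≡0 (λ x → δ-≢ {i = f (suc x)} {f zero} (λ eq → case inj eq of λ ()))))
... | no f0≢y = subst (λ k → k + sum (λ x → δ (f (suc x)) y) ≤ 1) (sym (δ-≢ f0≢y))
  (sum-δ-injective (f ∘ suc) (suc-injective ∘ inj) y)

select-image : ∀ {a b} (v : Vec (Fin b) a) → (∀ {x x′} → lookup v x ≡ lookup v x′ → x ≡ x′) →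
  ∀ y → select (lookup (image v) y) 1 ≡ sum (λ x → δ (lookup v x) y)
select-image v inj y with y ∈? image v
... | no y∉  = trans (select-∉ (image v) y y∉)
  (sym (sum-≡0 (λ x → δ-≢ {i = lookup v x} {y} (λ { refl → y∉ (lookup∈image v x) }))))
... | yes y∈ with image⁻ v y∈
...   | x , refl = trans (select-∈ y∈) (≤-antisym
  (≤-trans (≤-reflexive (sym (δ-refl y))) (term≤sum (λ x → δ (lookup v x) y) x))
  (sum-δ-injective (lookup v) inj y))

∣image∣ : ∀ {a b} {E : BipGraph a b} {v} → IsMatching E v → ∣ image v ∣ ≡ a
∣image∣ {a} {b} {v = v} match = begin
  ∣ image v ∣                                       ≡⟨ ∣∣≡weight (image v) ⟩
  sum (λ y → select (lookup (image v) y) 1)         ≡⟨ sum-cong-≗ (select-image v (distinct match)) ⟩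
  sum (λ y → sum (λ x → δ (lookup v x) y))          ≡⟨ ∑-comm (λ y x → δ (lookup v x) y) ⟩
  sum (λ x → sum (δ (lookup v x)))                  ≡⟨ sum-cong-≗ (λ x → sum-δ (lookup v x)) ⟩
  sum {a} (λ _ → 1)                                 ≡⟨ sum-const a 1 ⟩
  a * 1                                             ≡⟨ *-identityʳ a ⟩
  a                                                 ∎
  where open ≡-Reasoning

-- Hamming distance, the measure that decreases in `cover`.
disagreement : ∀ {a b} → Vec (Fin b) a → Vec (Fin b) a → ℕ
disagreement v w = sum (λ x → select (not ⌊ lookup v x ≟ lookup w x ⌋) 1)

-- No coordinate gets worse. If the total did not drop, no coordinate would improve either, but `x`
-- goes from 1 to 0.
disagreement-update : ∀ {a b} (v w : Vec (Fin b) a) {x} → lookup v x ≢ lookup w x →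
  disagreement v (w [ x ]≔ lookup v x) < disagreement v w
disagreement-update v w {x} v≢w = ≰⇒> λ w≤w′ → <-irrefl refl (begin-strict
    0         <⟨ s≤s z≤n ⟩
    1         ≡⟨ before ⟨
    dis w x   ≤⟨ sum-mono-≤⇒≥ decreasing w≤w′ x ⟩
    dis w′ x  ≡⟨ after ⟩
    0         ∎)
  where
  open ≤-Reasoning
  w′ = w [ x ]≔ lookup v x
  dis = λ u x → select (not ⌊ lookup v x ≟ lookup u x ⌋) 1
  before : dis w x ≡ 1
  before with lookup v x ≟ lookup w x
  ... | yes v≡w = contradiction v≡w v≢w
  ... | no _    = refl
  after : dis w′ x ≡ 0
  after with lookup v x ≟ lookup w′ x
  ... | yes _   = refl
  ... | no neq  = contradiction (sym (lookup∘update x w (lookup v x))) neq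
  decreasing : ∀ z → dis w′ z ≤ dis w z
  decreasing z with z ≟ x
  ... | yes refl = ≤-trans (≤-reflexive after) z≤n
  ... | no z≢x   = ≤-reflexive (cong (λ y → select (not ⌊ lookup v z ≟ y ⌋) 1) (lookup∘update′ z≢x w (lookup v x)))

update-matching : ∀ {a b} {E : BipGraph a b} {v w} → IsMatching E v → IsMatching E w → ∀ x →
  lookup v x ∉ image w → IsMatching E (w [ x ]≔ lookup v x)
update-matching {E = E} {v} {w} match-v match-w x vx∉w = mkMatching adj dist
  where
  w′ = w [ x ]≔ lookup v x
  at-x : lookup w′ x ≡ lookup v x
  at-x = lookup∘update x w (lookup v x)
  off-x : ∀ {z} → z ≢ x → lookup w′ z ≡ lookup w z
  off-x z≢x = lookup∘update′ z≢x w (lookup v x)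
  fresh : ∀ {z} → z ≢ x → lookup w′ x ≢ lookup w′ z
  fresh {z} z≢x eq = vx∉w (subst (_∈ image w) (sym (trans (sym at-x) (trans eq (off-x z≢x)))) (lookup∈image w z))
  adj : ∀ z → E z (lookup w′ z) ≡ true
  adj z with z ≟ x
  ... | yes refl = trans (cong (E z) at-x) (adjacent match-v z)
  ... | no z≢x   = trans (cong (E z) (off-x z≢x)) (adjacent match-w z)
  dist : ∀ {z z′} → lookup w′ z ≡ lookup w′ z′ → z ≡ z′
  dist {z} {z′} eq with z ≟ x | z′ ≟ x
  ... | yes refl | yes refl = refl
  ... | yes refl | no z′≢x  = contradiction eq (fresh z′≢x)
  ... | no z≢x   | yes refl = contradiction (sym eq) (fresh z≢x)
  ... | no z≢x   | no z′≢x  = distinct match-w (trans (sym (off-x z≢x)) (trans eq (off-x z′≢x)))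

-- As long as some element v x of S is not covered by w, redirect w at x to v x.
cover : ∀ {a b} {E : BipGraph a b} {S R v} → IsMatching E v → S ⊆ image v →
  ∀ n w → disagreement v w ≤ n → IsMatching E w → image w ⊆ S ∪ R →
  ∃ λ u → IsMatching E u × S ⊆ image u × image u ⊆ S ∪ R
cover {S = S} {R} {v} match-v S⊆v n w dis≤n match-w w⊆ with any? (λ y → (y ∈? S) ×-dec ¬? (y ∈? image w))
... | no  none = w , match-w , S⊆w , w⊆
  where
  S⊆w : S ⊆ image w
  S⊆w {y} y∈S with y ∈? image w
  ... | yes y∈w = y∈w
  ... | no  y∉w = contradiction (y , y∈S , y∉w) none
... | yes (y , y∈S , y∉w) with image⁻ v (S⊆v y∈S)
...   | x , refl = redirect n dis≤n
  where
  w′ = w [ x ]≔ lookup v x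
  -- The old value of `w` at `x` may itself lie in `S` and become uncovered, so progress is measured
  -- by the distance to `v` and not by the covered part of `S`.
  closer : disagreement v w′ < disagreement v w
  closer = disagreement-update v w (λ eq → y∉w (subst (_∈ image w) (sym eq) (lookup∈image w x)))
  w′⊆ : image w′ ⊆ S ∪ R
  w′⊆ z∈ with image⁻ w′ z∈
  ... | x′ , refl with x′ ≟ x
  ...   | yes refl = subst (_∈ S ∪ R) (sym (lookup∘update x w (lookup v x))) (x∈p∪q⁺ (inj₁ y∈S))
  ...   | no x′≢x  = subst (_∈ S ∪ R) (sym (lookup∘update′ x′≢x w (lookup v x))) (w⊆ (lookup∈image w x′))
  redirect : ∀ n → disagreement v w ≤ n → _
  redirect zero    dis≤0 = contradiction (≤-trans closer dis≤0) (λ ())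
  redirect (suc n) dis≤n = cover match-v S⊆v n w′ (≤-pred (≤-trans closer dis≤n))
    (update-matching match-v match-w x y∉w) w′⊆

matching-exchange : ∀ {a b} {E : BipGraph a b} {S v w} → IsMatching E v → S ⊆ image v →
  IsMatching E w → ∃ λ u → IsMatching E u × S ⊆ image u × image u ⊆ S ∪ image w
matching-exchange {w = w} match-v S⊆v match-w =
  cover match-v S⊆v _ w ≤-refl match-w (λ y∈w → x∈p∪q⁺ (inj₂ y∈w))

-- One entry per matching, with repetitions when images coincide, so that the length is the number
-- of complete matchings.
bases : ∀ {a b} → BipGraph a b → List (Subset b)
bases E = map image (matchings E)

cobases : ∀ {a b} → BipGraph a b → List (Subset b)
cobases E = map (∁ ∘ image) (matchings E)

bases-exchange : ∀ {a b} (E : BipGraph a b) → Exchange (bases E)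
bases-exchange {a} E = record
  { rank     = a
  ; size     = λ D∈ → case ∈-map⁻ image D∈ of λ
      { (v , v∈ , refl) → ∣image∣ (matchings-sound E v∈) }
  ; exchange = λ {S} D∈ S⊆D B∈ → ex (∈-map⁻ image D∈) S⊆D (∈-map⁻ image B∈)
  }
  where
  ex : ∀ {S D B} → (∃ λ v → v ∈ₗ matchings E × D ≡ image v) → S ⊆ D →
    (∃ λ w → w ∈ₗ matchings E × B ≡ image w) → ∃ λ D′ → D′ ∈ₗ bases E × S ⊆ D′ × D′ ⊆ S ∪ B
  ex (v , v∈ , refl) S⊆D (w , w∈ , refl)
    with matching-exchange (matchings-sound E v∈) S⊆D (matchings-sound E w∈)
  ... | u , match-u , S⊆u , u⊆ = image u , ∈-map⁺ image (matchings-complete E match-u) , S⊆u , u⊆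

-- Complementing, T ⊆ D′ ⊆ T ∪ ∁ (image w) says that ∁ D′ contains image w minus T and avoids T;
-- so extend image w minus T by elements of image v.
cobases-exchange : ∀ {a b} (E : BipGraph a b) → Exchange (cobases E)
cobases-exchange {a} {b} E = record
  { rank     = b ∸ a
  ; size     = λ D∈ → case ∈-map⁻ (∁ ∘ image) D∈ of λ
      { (v , v∈ , refl) → trans (∣∁p∣≡n∸∣p∣ (image v)) (cong (b ∸_) (∣image∣ (matchings-sound E v∈))) }
  ; exchange = λ {S} D∈ S⊆D B∈ → ex (∈-map⁻ (∁ ∘ image) D∈) S⊆D (∈-map⁻ (∁ ∘ image) B∈)
  }
  where
  ex : ∀ {T D B} → (∃ λ v → v ∈ₗ matchings E × D ≡ ∁ (image v)) → T ⊆ D →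
    (∃ λ w → w ∈ₗ matchings E × B ≡ ∁ (image w)) → ∃ λ D′ → D′ ∈ₗ cobases E × T ⊆ D′ × D′ ⊆ T ∪ B
  ex {T} (v , v∈ , refl) T⊆D (w , w∈ , refl)
    -- The roles are swapped compared with `bases-exchange`: `w` covers the set to be kept, and the
    -- matching being modified is `v`.
    with matching-exchange {S = image w ∩ ∁ T} (matchings-sound E w∈)
           (λ y∈ → proj₁ (x∈p∩q⁻ (image w) (∁ T) y∈)) (matchings-sound E v∈)
  ... | u , match-u , S⊆u , u⊆ = ∁ (image u) , ∈-map⁺ (∁ ∘ image) (matchings-complete E match-u) , T⊆ , ⊆T∪
    where
    T⊆ : T ⊆ ∁ (image u)
    T⊆ y∈T = x∉p⇒x∈∁p (λ y∈u → case x∈p∪q⁻ (image w ∩ ∁ T) (image v) (u⊆ y∈u) of λ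
      { (inj₁ y∈S) → x∈p⇒x∉∁p y∈T (proj₂ (x∈p∩q⁻ (image w) (∁ T) y∈S))
      ; (inj₂ y∈v) → x∈∁p⇒x∉p (T⊆D y∈T) y∈v })
    ⊆T∪ : ∁ (image u) ⊆ T ∪ ∁ (image w)
    ⊆T∪ {y} y∉u with y ∈? T | y ∈? image w
    ... | yes y∈T | _       = x∈p∪q⁺ (inj₁ y∈T)
    ... | no _    | no y∉w  = x∈p∪q⁺ (inj₂ (x∉p⇒x∈∁p y∉w))
    ... | no y∉T  | yes y∈w =
      contradiction (S⊆u (x∈p∩q⁺ (y∈w , x∉p⇒x∈∁p y∉T))) (x∈∁p⇒x∉p y∉u)

select-∁ : ∀ {n} (p : Subset n) e → select (lookup (∁ p) e) 1 ≡ 1 ∸ select (lookup p e) 1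
select-∁ (true  ∷ p) zero    = refl
select-∁ (false ∷ p) zero    = refl
select-∁ (_     ∷ p) (suc e) = select-∁ p e

-- The two bounds on the number of matchings and the conclusion

module _ {a b} {E : BipGraph a b} (M : BalancedMatchings E) where

  vec : Fin b → Vec (Fin b) a
  vec i = tabulate (matching M i)

  vec-isMatching : ∀ i → IsMatching E (vec i)
  vec-isMatching i = mkMatching
    (λ x → trans (cong (E x) (lookup∘tabulate (matching M i) x)) (edge M i x))
    (λ {x} {x′} eq → injective M i
      (trans (sym (lookup∘tabulate (matching M i) x)) (trans eq (lookup∘tabulate (matching M i) x′))))

  vec∈matchings : ∀ i → vec i ∈ₗ matchings E
  vec∈matchings i = matchings-complete E (vec-isMatching i)

  select-vec : ∀ i y → select (lookup (image (vec i)) y) 1 ≡ sum (λ x → δ (matching M i x) y)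
  select-vec i y = trans (select-image (vec i) (distinct (vec-isMatching i)) y)
    (sum-cong-≗ (λ x → cong (λ z → δ z y) (lookup∘tabulate (matching M i) x)))

  -- The `b` balanced matchings cover each element at most `a` times; `i₀` picks one of them as a
  -- member of the family.
  b^a≤ : Fin b → b ^ a ≤ numCompleteMatchings E * a ^ a
  b^a≤ i₀ = subst (λ N → b ^ a ≤ N * a ^ a) (length-map image (matchings E))
    (exchange-count (bases-exchange E) (∈-map⁺ image (vec∈matchings i₀)) b (image ∘ vec) a
      (λ i → ∈-map⁺ image (vec∈matchings i))
      (λ y → ≤-trans (≤-reflexive (sum-cong-≗ (λ i → select-vec i y))) (hits M y)))

  -- The dual count: complements of the images contain each element at most `b ∸ a` times.
  b^[b∸a]≤ : Fin b → b ^ (b ∸ a) ≤ numCompleteMatchings E * (b ∸ a) ^ (b ∸ a)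
  b^[b∸a]≤ i₀ = subst (λ N → b ^ (b ∸ a) ≤ N * (b ∸ a) ^ (b ∸ a)) (length-map (∁ ∘ image) (matchings E))
    (exchange-count (cobases-exchange E) (∈-map⁺ (∁ ∘ image) (vec∈matchings i₀)) b (∁ ∘ image ∘ vec) (b ∸ a)
      (λ i → ∈-map⁺ (∁ ∘ image) (vec∈matchings i))
      (λ y → ≤-trans (≤-reflexive (sum-cong-≗ (λ i →
        trans (select-∁ (image (vec i)) y) (cong (1 ∸_) (select-vec i y))))) (misses M y)))

-- `C≤square` is applied to the smaller of `a` and `r`, with the bound from the bases or from the
-- cobases; symmetry of the binomial coefficient joins the cases.
C≤numCompleteMatchings² : ∀ a r {E : BipGraph a (a + r)} → BalancedMatchings E → Fin (a + r) →
  (a + r) C a ≤ numCompleteMatchings E * numCompleteMatchings E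
C≤numCompleteMatchings² a r {E} M i₀ with a + a ≤? a + r
... | yes 2a≤b = C≤square a (a + r) (numCompleteMatchings E) 2a≤b (b^a≤ M i₀)
... | no  2a≰b = begin
  (a + r) C a                                       ≡⟨ nCk≡nC[n∸k] (m≤m+n a r) ⟩
  (a + r) C (a + r ∸ a)                             ≤⟨ C≤square (a + r ∸ a) (a + r) (numCompleteMatchings E) 2r≤b (b^[b∸a]≤ M i₀) ⟩
  numCompleteMatchings E * numCompleteMatchings E   ∎
  where
  open ≤-Reasoning
  2r≤b : a + r ∸ a + (a + r ∸ a) ≤ a + r
  2r≤b = begin
    a + r ∸ a + (a + r ∸ a)    ≡⟨ cong₂ _+_ (m+n∸m≡n a r) (m+n∸m≡n a r) ⟩
    r + r                      ≤⟨ +-monoˡ-≤ r (<⇒≤ (+-cancelˡ-< a r a (≰⇒> 2a≰b))) ⟩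
    a + r                      ∎

theorem4p2 : (a b : ℕ) (E : BipGraph a b) → NormalizedMatching E → a ≤ b →
    b C a ≤ numCompleteMatchings E * numCompleteMatchings E
-- Here `b` may be 0, leaving no balanced matching to pick; the empty matching is the only one, and
-- the count computes to 1.
theorem4p2 zero    b E normalized a≤b = ≤-reflexive (nC0≡1 b)
theorem4p2 (suc a) b E normalized a≤b with m≤n⇒∃[o]m+o≡n a≤b
... | r , refl = C≤numCompleteMatchings² (suc a) r (balanced-matchings (suc a) r E normalized) zero
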